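{- For every fixed integer parameter $p \geq 1$, the one-dimensional avalanche problem $\mathbf{AP}$ is in $\mathsf{NC}^1$. Here $\mathbf{AP}$ is the following decision problem. Instance: a stable monotone configuration $s \in \mathbf{gSM}$ (given as its sequence of slopes) and a column $k$ with $|s| < k \leq |s|+p$. Question: does adding a grain on column $1$ of $s$ trigger a grain addition on column $k$, that is, is the slope of column $k$ increased when $s^+$ is stabilized?
   Context: Fix an integer $p\ge 1$ (part of the model, not of the input). A configuration of the one-dimensional Kadanoff sandpile model is represented by its sequence of slopes $s=(s_i)_{i\in\mathbb{Z}}$ of integers. It has a length $|s|\in\mathbb{N}$, and $s_i=0$ for $i<1$ and for $i>|s|$. (If $h_1\ge\dots\ge h_n$ are the column heights, constant to the left of column $1$ and to the right of column $n$, then $s_i=h_i-h_{i+1}$ and $|s|=n-1$.) The configuration is monotone if $s_i\ge 0$ for $1\le i\le |s|$, and stable if $s_i\le p$ for every column $i$. $\mathbf{gSM}$ is the set of all stable monotone configurations, i.e. all finite sequences $s_1,\dots,s_{|s|}$ with entries in $\{0,\dots,p\}$, extended by $0$ on both sides. Transition rule: a column $i$ with $s_i>p$ may be fired, which replaces $s_{i-1}$ by $s_{i-1}+p$, $s_i$ by $s_i-(p+1)$, and $s_{i+p}$ by $s_{i+p}+1$, all other slopes being unchanged. For $s\in\mathbf{gSM}$, $s^+$ denotes $s$ with a grain added on column $1$, i.e. $s_1$ is replaced by $s_1+1$ and all other slopes are unchanged. Stabilizing $s^+$ means repeatedly firing columns until all columns are stable; the stable configuration reached does not depend on the order of firings,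 so the answer to $\mathbf{AP}$ is well defined. The size of an input is $\Theta(|s|)$. $\mathsf{NC}^1$ is the class of decision problems solvable by a uniform family of Boolean circuits (of bounded fan-in) of logarithmic depth and polynomial size in the input size; in the paper's convention this is seen as solvability in time $O(\log n)$ on polynomially many parallel PRAM processors. -}

module Defs where

open import Data.Bool.Base using (Bool; true; false; not; _∧_; _∨_; if_then_else_)
open import Data.Fin.Base as Fin using (Fin; toℕ; inject₁)
open import Data.Integer.Base as ℤ using (ℤ; +_; -[1+_])
import Data.Integer.Properties as ℤ
open import Data.List.Base using (List; []; _∷_; [_]; _++_; length; lookup; concat; applyUpTo)
open import Data.Nat.Base using (ℕ; zero; suc; _+_; _*_; _≤_; _<_; _<ᵇ_; _≡ᵇ_)
open import Data.Nat.Logarithm using (⌊log₂_⌋)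
open import Data.Product.Base using (Σ-syntax; ∃-syntax; _×_)
open import Data.Sum.Base using (_⊎_)
open import Data.Vec.Base as Vec using (Vec)
open import Function.Bundles using (_⇔_)
open import Relation.Binary.Construct.Closure.ReflexiveTransitive using (Star)
open import Relation.Binary.PropositionalEquality using (_≡_)
open import Relation.Nullary.Decidable using (⌊_⌋)
open import Relation.Nullary.Negation using (¬_)

------------------------------------------------------------------------
-- The Kadanoff sandpile model with parameter p

Slopes : Set
Slopes = ℤ → ℤ

-- addAt i d s is s with d added to the slope of column i.
addAt : ℤ → ℤ → Slopes → Slopes
addAt i d s j = if ⌊ i ℤ.≟ j ⌋ then s j ℤ.+ d else s j

fire : ℕ → ℤ → Slopes → Slopes
fire p i s =
  addAt (i ℤ.- + 1) (+ p)
    (addAt i (ℤ.- (+ suc p))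
      (addAt (i ℤ.+ + p) (+ 1) s))

data Step (p : ℕ) (s : Slopes) : Slopes → Set where
  step : ∀ i → + p ℤ.< s i → Step p s (fire p i s)

Stable : ℕ → Slopes → Set
Stable p s = ∀ i → s i ℤ.≤ + p

addGrain : Slopes → Slopes
addGrain = addAt (+ 1) (+ 1)

-- The stable monotone configurations.  The head of the list is s₁ and the
-- length |s| is the length of the list, so trailing zeros are significant.
gSM : ℕ → Set
gSM p = List (Fin (suc p))

-- nth s i is the slope of column i + 1.
nth : ∀ {p} → gSM p → ℕ → ℕ
nth []      _       = 0
nth (x ∷ _) zero    = toℕ x
nth (_ ∷ s) (suc i) = nth s i

slopes : ∀ {p} → gSM p → Slopes
slopes s (+ zero)  = + 0
slopes s (+ suc i) = + nth s i
slopes s -[1+ _ ]  = + 0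

-- The stable configuration reached does not depend on the order of firings,
-- so it does not matter that it is quantified existentially here.
Triggers : (p : ℕ) → gSM p → ℕ → Set
Triggers p s k =
  ∃[ t ] Star (Step p) (addGrain (slopes s)) t
       × Stable p t
       × addGrain (slopes s) (+ k) ℤ.< t (+ k)

------------------------------------------------------------------------
-- The avalanche problem as a language of bit strings

Language : Set₁
Language = List Bool → Set

-- 1ᵛ 0ᵖ⁻ᵛ, for v ≤ p
unary : ℕ → ℕ → List Bool
unary p v = applyUpTo (λ j → j <ᵇ v) p

-- The columns 1, …, |s| + p are listed in order.  Column i contributes its
-- slope, in unary on p bits, and one bit telling whether i = k.  The length
-- is (|s| + p) (p + 1), which is Θ(|s|) for fixed p.
encode : ∀ {p} → gSM p → ℕ → List Bool
encode {p} s k =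
  concat (applyUpTo (λ i → unary p (nth s i) ++ [ suc i ≡ᵇ k ]) (length s + p))

AP : ℕ → Language
AP p w =
  Σ[ s ∈ gSM p ] ∃[ k ]
    (length s < k × k ≤ length s + p) × w ≡ encode s k × Triggers p s k

------------------------------------------------------------------------
-- Boolean circuits of fan-in at most two

data Node (n : ℕ) (G : Set) : Set where
  input    : Fin n → Node n G
  const    : Bool → Node n G
  not-gate : G → Node n G
  and-gate : G → G → Node n G
  or-gate  : G → G → Node n G

-- A circuit with n inputs whose set of gates is G.
record Circuit (n : ℕ) (G : Set) : Set where
  field
    node   : G → Node n G
    output : G

module _ {n : ℕ} {G : Set} (C : Circuit n G) where
  open Circuit C

  -- Evaluates x ν b: on the input x, the node ν has value b.
  data Evaluates (x : Fin n → Bool) : Node n G → Bool → Set where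
    input : ∀ i → Evaluates x (input i) (x i)
    const : ∀ b → Evaluates x (const b) b
    not-gate : ∀ {g b} → Evaluates x (node g) b →
               Evaluates x (not-gate g) (not b)
    and-gate : ∀ {g h b c} → Evaluates x (node g) b → Evaluates x (node h) c →
               Evaluates x (and-gate g h) (b ∧ c)
    or-gate  : ∀ {g h b c} → Evaluates x (node g) b → Evaluates x (node h) c →
               Evaluates x (or-gate g h) (b ∨ c)

  -- Depth≤ d ν: every path from ν towards the inputs has at most d edges.
  -- In particular no cycle can be reached from ν.
  data Depth≤ : ℕ → Node n G → Set where
    input : ∀ {d} i → Depth≤ d (input i)
    const : ∀ {d} b → Depth≤ d (const b)
    not-gate : ∀ {d g} → Depth≤ d (node g) → Depth≤ (suc d) (not-gate g)
    and-gate : ∀ {d g h} → Depth≤ d (node g) → Depth≤ d (node h) →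
               Depth≤ (suc d) (and-gate g h)
    or-gate  : ∀ {d g h} → Depth≤ d (node g) → Depth≤ d (node h) →
               Depth≤ (suc d) (or-gate g h)

  Accepts : (Fin n → Bool) → Set
  Accepts x = Evaluates x (node output) true

------------------------------------------------------------------------
-- First-order logic over {0, …, N − 1} with order, addition and
-- multiplication; variables are de Bruijn indices.

infix  8 _≤ᶠ_ _+ᶠ_≐_ _*ᶠ_≐_
infixr 7 _∧ᶠ_
infixr 6 _∨ᶠ_

data Formula (m : ℕ) : Set where
  _≤ᶠ_      : (x y : Fin m) → Formula m
  _+ᶠ_≐_    : (x y z : Fin m) → Formula m
  _*ᶠ_≐_    : (x y z : Fin m) → Formula m
  ¬ᶠ_       : Formula m → Formula m
  _∧ᶠ_ _∨ᶠ_ : Formula m → Formula m → Formula m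
  ∃ᶠ ∀ᶠ     : Formula (suc m) → Formula m

infix 4 _⊨_

_⊨_ : ∀ {N m} → Vec (Fin N) m → Formula m → Set
ρ ⊨ x ≤ᶠ y     = toℕ (Vec.lookup ρ x) ≤ toℕ (Vec.lookup ρ y)
ρ ⊨ x +ᶠ y ≐ z = toℕ (Vec.lookup ρ x) + toℕ (Vec.lookup ρ y) ≡ toℕ (Vec.lookup ρ z)
ρ ⊨ x *ᶠ y ≐ z = toℕ (Vec.lookup ρ x) * toℕ (Vec.lookup ρ y) ≡ toℕ (Vec.lookup ρ z)
ρ ⊨ ¬ᶠ φ       = ¬ (ρ ⊨ φ)
ρ ⊨ φ ∧ᶠ ψ     = (ρ ⊨ φ) × (ρ ⊨ ψ)
ρ ⊨ φ ∨ᶠ ψ     = (ρ ⊨ φ) ⊎ (ρ ⊨ ψ)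
ρ ⊨ ∃ᶠ φ       = ∃[ a ] (a Vec.∷ ρ ⊨ φ)
ρ ⊨ ∀ᶠ φ       = ∀ a → a Vec.∷ ρ ⊨ φ

------------------------------------------------------------------------
-- Uniform NC¹

-- The gates of the n-th circuit of a family of arity k are the k-tuples over
-- {0, …, n + 1}, so the n-th circuit has (n + 2)ᵏ gates: the size of the
-- family is polynomial by construction.  (Two elements more than there are
-- inputs, so that 0 and 1 are distinct for every n.)
Name : ℕ → ℕ → Set
Name k n = Vec (Fin (suc (suc n))) k

Family : ℕ → Set
Family k = ∀ n → Circuit n (Name k n)

-- First-order (equivalently, DLOGTIME) uniformity, the usual notion for
-- classes inside logarithmic space: see Barrington, Immerman, Straubing, "On
-- uniformity within NC¹", and Immerman, "Descriptive complexity".  The types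
-- of the gates and the connections between them are defined by formulas that
-- do not depend on n.
record Uniform {k : ℕ} (C : Family k) : Set where
  open module C n = Circuit (C n) using (node; output)
  field
    inputᶠ  : Formula (suc k)
    constᶠ  : Bool → Formula k
    notᶠ    : Formula (k + k)
    andᶠ    : Formula (k + (k + k))
    orᶠ     : Formula (k + (k + k))
    outputᶠ : Formula k

    input-def  : ∀ n i g → node n g ≡ input i ⇔
                 (inject₁ (inject₁ i) Vec.∷ g ⊨ inputᶠ)
    const-def  : ∀ n b g → node n g ≡ const b ⇔ (g ⊨ constᶠ b)
    not-def    : ∀ n g h → node n g ≡ not-gate h ⇔ (g Vec.++ h ⊨ notᶠ)
    and-def    : ∀ n g h h′ → node n g ≡ and-gate h h′ ⇔
                 (g Vec.++ (h Vec.++ h′) ⊨ andᶠ)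
    or-def     : ∀ n g h h′ → node n g ≡ or-gate h h′ ⇔
                 (g Vec.++ (h Vec.++ h′) ⊨ orᶠ)
    output-def : ∀ n g → output n ≡ g ⇔ (g ⊨ outputᶠ)

record NC¹ (L : Language) : Set where
  field
    arity   : ℕ
    circuit : Family arity
    uniform : Uniform circuit

    -- The depth is O(log n); 1 + ⌊log₂ n⌋ is positive for every n.
    factor    : ℕ
    log-depth : ∀ n g → Depth≤ (circuit n) (factor * suc ⌊log₂ n ⌋)
                                (Circuit.node (circuit n) g)

    decides : ∀ w → L w ⇔ Accepts (circuit (length w)) (lookup w)

{-# OPTIONS --safe #-}
module Submission where

-- Reduction to automata: a column i fires in the avalanche iff it belongs to
-- every set G of columns that is closed under the firing rule, i.e. such that
-- s_i + p [i + 1 ∈ G] + [i - p ∈ G] ≤ p (with the grain added to s_1) whenever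
-- i ∉ G; the columns that fire, each of them once, form such a set.
-- Membership in G is a labelling of the columns and closure is checked in a
-- window of p + 2 labels, so a nondeterministic finite automaton accepts
-- exactly the words that are not in AP: it guesses a closed labelling with
-- k - p ∉ G, or else finds the word not to encode a valid instance.
--
-- Reduction of automata to circuits: a run from position a to position b
-- passes through some state at the midpoint of a and b.  Gates named by two
-- positions and two states therefore decide the existence of runs in depth
-- O(log n), and halving an interval is first-order definable from addition.

-- No column fires twice: it holds at most `p` at first, receives at most `p` from its right
-- neighbour and 1 from the column `p` to its left, and one firing takes away `p + 1`. So the set of
-- fired columns determines all slopes, and it is the least closed set. Being in a least set is a
-- universal statement over closed sets; it is therefore the complement of AP that has the
-- existential form of an automaton. Gates are accordingly false when a path exists, which
-- complements at no cost and avoids determinization.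
--
-- The grain is treated as the firing of a virtual column `1 - p`, so that closure has one form for
-- all columns. Configurations of length 0 are kept apart: there the grain can land on column `k`
-- itself, which does not count as triggering.
--
-- Uniformity and the depth bound are demanded of every gate name, also of names that the output
-- never reaches. Hence a circuit is given as a decision tree on the coordinates of a name, total by
-- construction, from which both the gates and their defining formulas are computed.

open import Defs
open import Data.Bool.Base using (Bool; true; false; not; _∧_; _∨_; if_then_else_)
import Data.Bool.Properties as Bool
open import Data.Empty using (⊥)
open import Data.Fin.Base as Fin using (Fin; zero; suc; toℕ; inject₁; fromℕ<; fromℕ; _↑ˡ_; _↑ʳ_; combine; remQuot)
import Data.Fin.Properties as Fin
open import Data.List.Base as List using (List; []; _∷_; length; concat; applyUpTo; _++_; [_])
import Data.List.Properties as List
open import Data.List.Relation.Unary.All as All using (All; []; _∷_)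
import Data.List.Relation.Unary.All.Properties as All
open import Data.Maybe.Base using (Maybe; just; nothing)
open import Data.Nat.Base
open import Data.Nat.DivMod using (m<n⇒m%n≡m; [m+kn]%n≡m%n; m*n%n≡0)
open import Data.Nat.Logarithm using (⌊log₂_⌋; ⌊log₂[2^n]⌋≡n; ⌊log₂⌋-mono-≤)
open import Data.Nat.Properties
open import Data.Product.Base using (∃; ∃-syntax; Σ-syntax; _×_; _,_; proj₁; proj₂)
import Data.Product.Properties as Product
open import Data.Sum.Base using (_⊎_; inj₁; inj₂; [_,_]′)
import Data.Sum.Properties as Sum
open import Data.Unit.Base using (⊤; tt)
open import Data.Vec.Base as Vec using (Vec; []; _∷_; lookup; tabulate; replicate)
import Data.Vec.Properties as Vec
open import Function.Base using (_∘_; id)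
open import Function.Bundles using (_⇔_; mk⇔; Equivalence)
open import Relation.Binary.Construct.Closure.ReflexiveTransitive using (Star; ε; _◅_)
open import Relation.Binary.Definitions using (DecidableEquality)
open import Relation.Binary.PropositionalEquality hiding ([_])
open import Relation.Nullary.Decidable using (Dec; yes; no; does; ¬?; _×-dec_; _⊎-dec_; _→-dec_; map′; isYes≗does)
open import Relation.Nullary.Negation using (¬_; contradiction)
open Equivalence using (to; from)

-- First-order definability

module _ {N : ℕ} where

  infix 4 _⊨?_

  _⊨?_ : ∀ {m} (ρ : Vec (Fin N) m) φ → Dec (ρ ⊨ φ)
  ρ ⊨? x ≤ᶠ y     = toℕ (lookup ρ x) ≤? toℕ (lookup ρ y)
  ρ ⊨? x +ᶠ y ≐ z = toℕ (lookup ρ x) + toℕ (lookup ρ y) ≟ toℕ (lookup ρ z)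
  ρ ⊨? x *ᶠ y ≐ z = toℕ (lookup ρ x) * toℕ (lookup ρ y) ≟ toℕ (lookup ρ z)
  ρ ⊨? ¬ᶠ φ       = ¬? (ρ ⊨? φ)
  ρ ⊨? φ ∧ᶠ ψ     = (ρ ⊨? φ) ×-dec (ρ ⊨? ψ)
  ρ ⊨? φ ∨ᶠ ψ     = (ρ ⊨? φ) ⊎-dec (ρ ⊨? ψ)
  ρ ⊨? ∃ᶠ φ       = Fin.any? λ a → a ∷ ρ ⊨? φ
  ρ ⊨? ∀ᶠ φ       = Fin.all? λ a → a ∷ ρ ⊨? φ

lift : ∀ {m m′} → (Fin m → Fin m′) → Fin (suc m) → Fin (suc m′)
lift σ zero    = zero
lift σ (suc x) = suc (σ x)

rename : ∀ {m m′} → (Fin m → Fin m′) → Formula m → Formula m′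
rename σ (x ≤ᶠ y)     = σ x ≤ᶠ σ y
rename σ (x +ᶠ y ≐ z) = σ x +ᶠ σ y ≐ σ z
rename σ (x *ᶠ y ≐ z) = σ x *ᶠ σ y ≐ σ z
rename σ (¬ᶠ φ)       = ¬ᶠ rename σ φ
rename σ (φ ∧ᶠ ψ)     = rename σ φ ∧ᶠ rename σ ψ
rename σ (φ ∨ᶠ ψ)     = rename σ φ ∨ᶠ rename σ ψ
rename σ (∃ᶠ φ)       = ∃ᶠ (rename (lift σ) φ)
rename σ (∀ᶠ φ)       = ∀ᶠ (rename (lift σ) φ)

Along : ∀ {m m′} {A : Set} → (Fin m → Fin m′) → Vec A m → Vec A m′ → Set
Along σ ρ ρ′ = ∀ x → lookup ρ′ (σ x) ≡ lookup ρ x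

along-lift : ∀ {m m′} {A : Set} {σ : Fin m → Fin m′} {ρ ρ′} (a : A) →
             Along σ ρ ρ′ → Along (lift σ) (a ∷ ρ) (a ∷ ρ′)
along-lift a e zero    = refl
along-lift a e (suc x) = e x

rename-⊨ : ∀ {N m m′} (σ : Fin m → Fin m′) {ρ : Vec (Fin N) m} {ρ′} →
           Along σ ρ ρ′ → ∀ φ → ρ ⊨ φ ⇔ ρ′ ⊨ rename σ φ
rename-⊨ σ e (x ≤ᶠ y)     rewrite e x | e y       = mk⇔ id id
rename-⊨ σ e (x +ᶠ y ≐ z) rewrite e x | e y | e z = mk⇔ id id
rename-⊨ σ e (x *ᶠ y ≐ z) rewrite e x | e y | e z = mk⇔ id id
rename-⊨ σ e (¬ᶠ φ)       = mk⇔ (λ p q → p (from (rename-⊨ σ e φ) q)) (λ p q → p (to (rename-⊨ σ e φ) q))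
rename-⊨ σ e (φ ∧ᶠ ψ)     = mk⇔ (λ (p , q) → to (rename-⊨ σ e φ) p , to (rename-⊨ σ e ψ) q)
                                (λ (p , q) → from (rename-⊨ σ e φ) p , from (rename-⊨ σ e ψ) q)
rename-⊨ σ e (φ ∨ᶠ ψ)     = mk⇔ [ inj₁ ∘ to (rename-⊨ σ e φ) , inj₂ ∘ to (rename-⊨ σ e ψ) ]′
                                [ inj₁ ∘ from (rename-⊨ σ e φ) , inj₂ ∘ from (rename-⊨ σ e ψ) ]′
rename-⊨ σ e (∃ᶠ φ)       = mk⇔ (λ (a , p) → a , to (rename-⊨ (lift σ) (along-lift a e) φ) p)
                                (λ (a , p) → a , from (rename-⊨ (lift σ) (along-lift a e) φ) p)
rename-⊨ σ e (∀ᶠ φ)       = mk⇔ (λ p a → to (rename-⊨ (lift σ) (along-lift a e) φ) (p a))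
                                (λ p a → from (rename-⊨ (lift σ) (along-lift a e) φ) (p a))

-- Definability of constants, successor and midpoint

infix 8 _<ᶠ_ _≐_

trueᶠ falseᶠ : ∀ {m} → Formula m
trueᶠ  = ∀ᶠ (zero ≤ᶠ zero)
falseᶠ = ¬ᶠ trueᶠ

_<ᶠ_ _≐_ : ∀ {m} → Fin m → Fin m → Formula m
x <ᶠ y = ¬ᶠ (y ≤ᶠ x)
x ≐ y  = x ≤ᶠ y ∧ᶠ y ≤ᶠ x

isZeroᶠ isOneᶠ isMaxᶠ : ∀ {m} → Fin m → Formula m
isZeroᶠ x = x +ᶠ x ≐ x
isOneᶠ x  = x *ᶠ x ≐ x ∧ᶠ ¬ᶠ isZeroᶠ x
isMaxᶠ x  = ∀ᶠ (zero ≤ᶠ suc x)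

isSucᶠ : ∀ {m} → Fin m → Fin m → Formula m
isSucᶠ x y = ∃ᶠ (isOneᶠ zero ∧ᶠ suc x +ᶠ zero ≐ suc y)

midpoint : ℕ → ℕ → ℕ
midpoint a b = a + ⌊ b ∸ a /2⌋

-- With `e` half the distance, `y` is `z + e` or `z + e + 1`. Quantifiers range over a bounded
-- universe, but none of these sums exceeds `y`. The last disjunct matches truncated subtraction:
-- the midpoint of a reversed interval is its first endpoint.
isMidᶠ : ∀ {m} → Fin m → Fin m → Fin m → Formula m
isMidᶠ x y z =
  (x ≤ᶠ y ∧ᶠ ∃ᶠ (suc x +ᶠ zero ≐ suc z ∧ᶠ
                 (suc z +ᶠ zero ≐ suc y ∨ᶠ
                  ∃ᶠ (suc (suc z) +ᶠ suc zero ≐ zero ∧ᶠ isSucᶠ zero (suc (suc y))))))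
  ∨ᶠ (y ≤ᶠ x ∧ᶠ x ≐ z)

module _ {n m : ℕ} (ρ : Vec (Fin (suc (suc n))) m) where

  private
    ⟨_⟩ : Fin m → ℕ
    ⟨ x ⟩ = toℕ (lookup ρ x)

  ⊨-true : ρ ⊨ trueᶠ
  ⊨-true a = ≤-refl

  ⊨-false : ¬ (ρ ⊨ falseᶠ)
  ⊨-false p = p ⊨-true

  ⊨-< : ∀ x y → ρ ⊨ x <ᶠ y ⇔ ⟨ x ⟩ < ⟨ y ⟩
  ⊨-< _ _ = mk⇔ ≰⇒> <⇒≱

  ⊨-≐ : ∀ x y → ρ ⊨ x ≐ y ⇔ lookup ρ x ≡ lookup ρ y
  ⊨-≐ _ _ = mk⇔ (λ (p , q) → Fin.toℕ-injective (≤-antisym p q))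
            (λ e → ≤-reflexive (cong toℕ e) , ≤-reflexive (cong toℕ (sym e)))

  ⊨-isZero : ∀ x → ρ ⊨ isZeroᶠ x ⇔ lookup ρ x ≡ zero
  ⊨-isZero x = mk⇔ (λ e → Fin.toℕ-injective (n+n≡n⇒n≡0 e)) (λ e → subst (λ a → toℕ a + toℕ a ≡ toℕ a) (sym e) refl)
    where
    n+n≡n⇒n≡0 : ∀ {k} → k + k ≡ k → k ≡ 0
    n+n≡n⇒n≡0 {k} e = +-cancelʳ-≡ k k 0 e

  ⊨-isOne : ∀ x → ρ ⊨ isOneᶠ x ⇔ lookup ρ x ≡ suc zero
  ⊨-isOne x = mk⇔ (λ (p , q) → one (lookup ρ x) p q)
                    (λ e → subst (λ a → toℕ a * toℕ a ≡ toℕ a × ¬ (toℕ a + toℕ a ≡ toℕ a)) (sym e) (refl , λ ()))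
    where
    one : ∀ (a : Fin (suc (suc n))) → toℕ a * toℕ a ≡ toℕ a → ¬ (toℕ a + toℕ a ≡ toℕ a) → a ≡ suc zero
    one zero    _ q = contradiction refl q
    one (suc a) p _ = cong suc (Fin.toℕ-injective (suc-injective (*-cancelʳ-≡ _ 1 (suc (toℕ a)) (trans p (sym (*-identityˡ _))))))

  ⊨-isMax : ∀ x → ρ ⊨ isMaxᶠ x ⇔ ⟨ x ⟩ ≡ suc n
  ⊨-isMax x = mk⇔ (λ p → ≤-antisym (Fin.toℕ≤pred[n] (lookup ρ x)) (subst (_≤ ⟨ x ⟩) (Fin.toℕ-fromℕ (suc n)) (p (fromℕ (suc n)))))
                (λ e a → subst (toℕ a ≤_) (sym e) (Fin.toℕ≤pred[n] a))

module _ {n m : ℕ} (ρ : Vec (Fin (suc (suc n))) m) where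

  private
    ⟨_⟩ : Fin m → ℕ
    ⟨ x ⟩ = toℕ (lookup ρ x)

  ⊨-isSuc : ∀ x y → ρ ⊨ isSucᶠ x y ⇔ suc ⟨ x ⟩ ≡ ⟨ y ⟩
  ⊨-isSuc x y = mk⇔ right left
    where
    right : ρ ⊨ isSucᶠ x y → suc ⟨ x ⟩ ≡ ⟨ y ⟩
    right (a , p , e) with refl ← to (⊨-isOne (a ∷ ρ) zero) p = trans (+-comm 1 _) e
    left : suc ⟨ x ⟩ ≡ ⟨ y ⟩ → ρ ⊨ isSucᶠ x y
    left e = suc zero , from (⊨-isOne (suc zero ∷ ρ) zero) refl , trans (+-comm _ 1) e

even-or-odd : ∀ k → k ≡ ⌊ k /2⌋ + ⌊ k /2⌋ ⊎ k ≡ suc (⌊ k /2⌋ + ⌊ k /2⌋)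
even-or-odd 0             = inj₁ refl
even-or-odd 1             = inj₂ refl
even-or-odd (suc (suc k)) with even-or-odd k
... | inj₁ e = inj₁ (trans (cong (2 +_) e) (cong suc (sym (+-suc _ _))))
... | inj₂ e = inj₂ (trans (cong (2 +_) e) (cong (2 +_) (sym (+-suc _ _))))

midpoint-even : ∀ a e → midpoint a (a + e + e) ≡ a + e
midpoint-even a e rewrite +-assoc a e e | m+n∸m≡n a (e + e) = cong (a +_) (sym (n≡⌊n+n/2⌋ e))

midpoint-odd : ∀ a e → midpoint a (suc (a + e + e)) ≡ a + e
midpoint-odd a e rewrite +-assoc a e e | sym (+-suc a (e + e)) | m+n∸m≡n a (suc (e + e)) =
  cong (a +_) (sym (n≡⌈n+n/2⌉ e))

midpoint-≥ : ∀ {a b} → b ≤ a → midpoint a b ≡ a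
midpoint-≥ {a} {b} b≤a rewrite m≤n⇒m∸n≡0 b≤a = +-identityʳ a

midpoint-≤ : ∀ {a b} → a ≤ b → midpoint a b ≤ b
midpoint-≤ {a} {b} a≤b = ≤-trans (+-monoʳ-≤ a (⌊n/2⌋≤n (b ∸ a))) (≤-reflexive (m+[n∸m]≡n a≤b))

midpoint-< : ∀ {N a b} → a < N → b < N → midpoint a b < N
midpoint-< {N} {a} {b} a<N b<N with ≤-total a b
... | inj₁ a≤b = ≤-<-trans (midpoint-≤ a≤b) b<N
... | inj₂ b≤a = subst (_< N) (sym (midpoint-≥ b≤a)) a<N

midpointᶠ : ∀ {N} → Fin N → Fin N → Fin N
midpointᶠ a b = fromℕ< (midpoint-< (Fin.toℕ<n a) (Fin.toℕ<n b))

toℕ-midpointᶠ : ∀ {N} (a b : Fin N) → toℕ (midpointᶠ a b) ≡ midpoint (toℕ a) (toℕ b)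
toℕ-midpointᶠ a b = Fin.toℕ-fromℕ< _

module _ {n m : ℕ} (ρ : Vec (Fin (suc (suc n))) m) where

  private
    ⟨_⟩ : Fin m → ℕ
    ⟨ x ⟩ = toℕ (lookup ρ x)

  ⊨-isMid : ∀ x y z → ρ ⊨ isMidᶠ x y z ⇔ lookup ρ z ≡ midpointᶠ (lookup ρ x) (lookup ρ y)
  ⊨-isMid x y z = mk⇔ right left
    where
    mid : ℕ
    mid = midpoint ⟨ x ⟩ ⟨ y ⟩

    rightℕ : ρ ⊨ isMidᶠ x y z → ⟨ z ⟩ ≡ mid
    rightℕ (inj₁ (x≤y , e , x+e≡z , inj₁ z+e≡y)) =
      sym (trans (cong (midpoint ⟨ x ⟩) (trans (sym z+e≡y) (cong (_+ toℕ e) (sym x+e≡z))))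
                 (trans (midpoint-even ⟨ x ⟩ (toℕ e)) x+e≡z))
    rightℕ (inj₁ (x≤y , e , x+e≡z , inj₂ (u , z+e≡u , 1+u≡y))) =
      sym (trans (cong (midpoint ⟨ x ⟩) (trans (sym (to (⊨-isSuc (u ∷ e ∷ ρ) zero (suc (suc y))) 1+u≡y))
                   (cong suc (trans (sym z+e≡u) (cong (_+ toℕ e) (sym x+e≡z))))))
                 (trans (midpoint-odd ⟨ x ⟩ (toℕ e)) x+e≡z))
    rightℕ (inj₂ (y≤x , x≐z)) = trans (cong toℕ (sym (to (⊨-≐ ρ x z) x≐z))) (sym (midpoint-≥ y≤x))

    right : ρ ⊨ isMidᶠ x y z → lookup ρ z ≡ midpointᶠ (lookup ρ x) (lookup ρ y)
    right p = Fin.toℕ-injective (trans (rightℕ p) (sym (toℕ-midpointᶠ (lookup ρ x) (lookup ρ y))))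

    left : lookup ρ z ≡ midpointᶠ (lookup ρ x) (lookup ρ y) → ρ ⊨ isMidᶠ x y z
    left p with ≤-total ⟨ x ⟩ ⟨ y ⟩
    ... | inj₂ y≤x = inj₂ (y≤x , from (⊨-≐ ρ x z) (Fin.toℕ-injective (sym (trans z≡mid (midpoint-≥ y≤x)))))
      where
      z≡mid : ⟨ z ⟩ ≡ mid
      z≡mid = trans (cong toℕ p) (toℕ-midpointᶠ (lookup ρ x) (lookup ρ y))
    ... | inj₁ x≤y = inj₁ (x≤y , fromℕ< half<N , trans (cong (⟨ x ⟩ +_) half≡) (sym z≡mid) , parts (even-or-odd (⟨ y ⟩ ∸ ⟨ x ⟩)))
      where
      half : ℕ
      half = ⌊ ⟨ y ⟩ ∸ ⟨ x ⟩ /2⌋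
      half<N : half < suc (suc n)
      half<N = ≤-<-trans (≤-trans (⌊n/2⌋≤n _) (m∸n≤m ⟨ y ⟩ ⟨ x ⟩)) (Fin.toℕ<n (lookup ρ y))
      half≡ : toℕ (fromℕ< half<N) ≡ half
      half≡ = Fin.toℕ-fromℕ< half<N
      z≡mid : ⟨ z ⟩ ≡ mid
      z≡mid = trans (cong toℕ p) (toℕ-midpointᶠ (lookup ρ x) (lookup ρ y))
      z+half : ⟨ z ⟩ + half ≡ ⟨ x ⟩ + (half + half)
      z+half = trans (cong (_+ half) z≡mid) (+-assoc ⟨ x ⟩ half half)
      parts : ⟨ y ⟩ ∸ ⟨ x ⟩ ≡ half + half ⊎ ⟨ y ⟩ ∸ ⟨ x ⟩ ≡ suc (half + half) → _
      parts (inj₁ e) = inj₁ (trans (cong (⟨ z ⟩ +_) half≡)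
        (trans z+half (trans (cong (⟨ x ⟩ +_) (sym e)) (m+[n∸m]≡n x≤y))))
      parts (inj₂ e) = inj₂ (fromℕ< u<N , trans (cong (⟨ z ⟩ +_) half≡) (sym u≡) ,
                             from (⊨-isSuc (fromℕ< u<N ∷ fromℕ< half<N ∷ ρ) zero (suc (suc y))) (trans (cong suc u≡) 1+u≡y))
        where
        1+u≡y : suc (⟨ z ⟩ + half) ≡ ⟨ y ⟩
        1+u≡y = trans (cong suc z+half) (trans (sym (+-suc _ _)) (trans (cong (⟨ x ⟩ +_) (sym e)) (m+[n∸m]≡n x≤y)))
        u<N : ⟨ z ⟩ + half < suc (suc n)
        u<N = ≤-trans (≤-reflexive 1+u≡y) (<⇒≤ (Fin.toℕ<n (lookup ρ y)))
        u≡ : toℕ (fromℕ< u<N) ≡ ⟨ z ⟩ + half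
        u≡ = Fin.toℕ-fromℕ< u<N

-- The formulas have no function symbols, so a function on names travels with a formula for its
-- graph. The coordinates of a gate's children are such functions.
record Term (k : ℕ) : Set where
  field
    value : ∀ {n} → Name k n → Fin (suc (suc n))
    graph : Formula (suc k)
    spec  : ∀ {n} (g : Name k n) y → y ∷ g ⊨ graph ⇔ y ≡ value g

open Term

var : ∀ {k} → Fin k → Term k
var x .value g  = lookup g x
var x .graph    = zero ≐ suc x
var x .spec g y = ⊨-≐ (y ∷ g) zero (suc x)

zeroᵗ oneᵗ maxᵗ : ∀ {k} → Term k
zeroᵗ .value _  = zero
zeroᵗ .graph    = isZeroᶠ zero
zeroᵗ .spec g y = ⊨-isZero (y ∷ g) zero
oneᵗ .value _  = suc zero
oneᵗ .graph    = isOneᶠ zero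
oneᵗ .spec g y = ⊨-isOne (y ∷ g) zero
maxᵗ .value _  = fromℕ _
maxᵗ .graph    = isMaxᶠ zero
maxᵗ .spec {n} g y = mk⇔
  (λ p → Fin.toℕ-injective (trans (to (⊨-isMax (y ∷ g) zero) p) (sym (Fin.toℕ-fromℕ (suc n)))))
  (λ e → from (⊨-isMax (y ∷ g) zero) (trans (cong toℕ e) (Fin.toℕ-fromℕ (suc n))))

bitᵗ : ∀ {k} → Bool → Term k
bitᵗ b = if b then oneᵗ else zeroᵗ

midᵗ : ∀ {k} → Fin k → Fin k → Term k
midᵗ x y .value g  = midpointᶠ (lookup g x) (lookup g y)
midᵗ x y .graph    = isMidᶠ (suc x) (suc y) zero
midᵗ x y .spec g b = ⊨-isMid (b ∷ g) (suc x) (suc y) zero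

Substitution : ℕ → ℕ → Set
Substitution k l = Fin l → Term k

apply : ∀ {k l n} → Substitution k l → Name k n → Name l n
apply S g = tabulate λ i → value (S i) g

conjunction : ∀ {m} k → (Fin k → Formula m) → Formula m
conjunction zero    φ = trueᶠ
conjunction (suc k) φ = φ zero ∧ᶠ conjunction k (φ ∘ suc)

⊨-conjunction : ∀ {m n} (ρ : Name m n) k (φ : Fin k → Formula m) →
                ρ ⊨ conjunction k φ ⇔ (∀ i → ρ ⊨ φ i)
⊨-conjunction ρ zero    φ = mk⇔ (λ _ ()) (λ _ → ⊨-true ρ)
⊨-conjunction ρ (suc k) φ = mk⇔
  (λ { (p , ps) zero → p ; (p , ps) (suc i) → to (⊨-conjunction ρ k (φ ∘ suc)) ps i })
  (λ p → p zero , from (⊨-conjunction ρ k (φ ∘ suc)) (p ∘ suc))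

cons : ∀ {k m} → Fin m → (Fin k → Fin m) → Fin (suc k) → Fin m
cons y σ zero    = y
cons y σ (suc x) = σ x

along-cons : ∀ {k m} {A : Set} {g : Vec A k} {ρ : Vec A m} {σ : Fin k → Fin m} {y a} →
             lookup ρ y ≡ a → Along σ g ρ → Along (cons y σ) (a ∷ g) ρ
along-cons e f zero    = e
along-cons e f (suc x) = f x

-- `σ` and `τ` locate the coordinates of parent and child in a common environment, so that one
-- formula serves for the child of a negation and for either child of a binary gate.
isApplyᶠ : ∀ {k l m} → Substitution k l → (Fin k → Fin m) → (Fin l → Fin m) → Formula m
isApplyᶠ S σ τ = conjunction _ λ i → rename (cons (τ i) σ) (graph (S i))

⊨-isApply : ∀ {k l m n} (S : Substitution k l) {σ : Fin k → Fin m} {τ} {ρ : Name m n} {g h} →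
            Along σ g ρ → Along τ h ρ → h ≡ apply S g ⇔ ρ ⊨ isApplyᶠ S σ τ
⊨-isApply {l = l} S {σ} {τ} {ρ} {g} {h} σ-ok τ-ok = mk⇔
  (λ e → from (⊨-conjunction ρ l _) λ i →
     to (rename-⊨ (cons (τ i) σ) (along-cons {ρ = ρ} (τ-ok i) σ-ok) (graph (S i)))
        (from (spec (S i) g (lookup h i)) (trans (cong (λ v → lookup v i) e) (Vec.lookup∘tabulate _ i))))
  (λ p → trans (sym (Vec.tabulate∘lookup h)) (Vec.tabulate-cong λ i →
     to (spec (S i) g (lookup h i))
        (from (rename-⊨ (cons (τ i) σ) (along-cons {ρ = ρ} (τ-ok i) σ-ok) (graph (S i))) (to (⊨-conjunction ρ l _) p i))))

-- Uniform circuits from decision trees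

data Kind (k : ℕ) : Set where
  input    : Fin k → Kind k
  const    : Bool → Kind k
  not-gate : Substitution k k → Kind k
  and-gate : Substitution k k → Substitution k k → Kind k
  or-gate  : Substitution k k → Substitution k k → Kind k

data Tree (k : ℕ) : Set where
  leaf : Kind k → Tree k
  ite  : Formula k → Tree k → Tree k → Tree k

-- A coordinate takes `n + 2` values but there are `n` inputs; the two surplus values give a
-- constant, so that every name denotes a node.
inputNode : ∀ {n G} → Fin (suc (suc n)) → Node n G
inputNode {n} a with toℕ a <? n
... | yes a<n = input (fromℕ< a<n)
... | no  _   = const false

kindNode : ∀ {k n} → Kind k → Name k n → Node n (Name k n)
kindNode (input x)      g = inputNode (lookup g x)
kindNode (const b)      g = const b
kindNode (not-gate S)   g = not-gate (apply S g)
kindNode (and-gate S T) g = and-gate (apply S g) (apply T g)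
kindNode (or-gate S T)  g = or-gate (apply S g) (apply T g)

treeNode : ∀ {k n} → Tree k → Name k n → Node n (Name k n)
treeNode (leaf κ)    g = kindNode κ g
treeNode (ite φ T U) g with g ⊨? φ
... | yes _ = treeNode T g
... | no  _ = treeNode U g

treeᶠ : ∀ {k m} → (Fin k → Fin m) → (Kind k → Formula m) → Tree k → Formula m
treeᶠ σ F (leaf κ)    = F κ
treeᶠ σ F (ite φ T U) = (rename σ φ ∧ᶠ treeᶠ σ F T) ∨ᶠ (rename σ (¬ᶠ φ) ∧ᶠ treeᶠ σ F U)

-- `ν` and `F` are arbitrary, so a single induction covers all five forms of node and leaves only
-- the comparison at the leaves.
⊨-tree : ∀ {k m n} {σ : Fin k → Fin m} {F : Kind k → Formula m} {ρ : Name m n} {g ν} →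
         Along σ g ρ → (∀ κ → kindNode κ g ≡ ν ⇔ ρ ⊨ F κ) →
         ∀ T → treeNode T g ≡ ν ⇔ ρ ⊨ treeᶠ σ F T
⊨-tree σ-ok κ-ok (leaf κ) = κ-ok κ
⊨-tree {σ = σ} {g = g} σ-ok κ-ok (ite φ T U) with g ⊨? φ
... | yes p = mk⇔ (λ e → inj₁ (to (rename-⊨ σ σ-ok φ) p , to (⊨-tree σ-ok κ-ok T) e))
                  [ (λ (_ , q) → from (⊨-tree σ-ok κ-ok T) q)
                  , (λ (q , _) → contradiction p (from (rename-⊨ σ σ-ok (¬ᶠ φ)) q)) ]′
... | no ¬p = mk⇔ (λ e → inj₂ (to (rename-⊨ σ σ-ok (¬ᶠ φ)) ¬p , to (⊨-tree σ-ok κ-ok U) e))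
                  [ (λ (q , _) → contradiction (from (rename-⊨ σ σ-ok φ) q) ¬p)
                  , (λ (_ , q) → from (⊨-tree σ-ok κ-ok U) q) ]′

module _ {k : ℕ} where

  inputKindᶠ : Kind k → Formula (suc k)
  inputKindᶠ (input x) = zero ≐ suc x
  inputKindᶠ _         = falseᶠ

  constKindᶠ : Bool → Kind k → Formula k
  -- An input leaf is constant exactly when the coordinate is `n` or `n + 1`, the elements with
  -- fewer than two elements above them.
  constKindᶠ false (input x)     = ¬ᶠ (∃ᶠ (∃ᶠ (suc (suc x) <ᶠ suc zero ∧ᶠ suc zero <ᶠ zero)))
  constKindᶠ true  (const true)  = trueᶠ
  constKindᶠ false (const false) = trueᶠ
  constKindᶠ _     _             = falseᶠ

  notKindᶠ : Kind k → Formula (k + k)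
  notKindᶠ (not-gate S) = isApplyᶠ S (_↑ˡ k) (k ↑ʳ_)
  notKindᶠ _            = falseᶠ

  binaryᶠ : Substitution k k → Substitution k k → Formula (k + (k + k))
  binaryᶠ S T = isApplyᶠ S (_↑ˡ (k + k)) (λ i → k ↑ʳ (i ↑ˡ k)) ∧ᶠ
                isApplyᶠ T (_↑ˡ (k + k)) (λ i → k ↑ʳ (k ↑ʳ i))

  andKindᶠ orKindᶠ : Kind k → Formula (k + (k + k))
  andKindᶠ (and-gate S T) = binaryᶠ S T
  andKindᶠ _              = falseᶠ
  orKindᶠ (or-gate S T) = binaryᶠ S T
  orKindᶠ _             = falseᶠ

module _ {k n : ℕ} where

  private
    false-⇔ : ∀ {m} (ρ : Name m n) {A : Set} → ¬ A → A ⇔ ρ ⊨ falseᶠ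
    false-⇔ ρ ¬a = mk⇔ (λ a → contradiction a ¬a) (λ p → contradiction p (⊨-false ρ))

    true-⇔ : ∀ {m} (ρ : Name m n) {A : Set} → A → A ⇔ ρ ⊨ trueᶠ
    true-⇔ ρ a = mk⇔ (λ _ → ⊨-true ρ) (λ _ → a)

  toℕ-inject₁² : ∀ (i : Fin n) → toℕ (inject₁ (inject₁ i)) ≡ toℕ i
  toℕ-inject₁² i = trans (Fin.toℕ-inject₁ (inject₁ i)) (Fin.toℕ-inject₁ i)

  inputNode-input : ∀ {G} (a : Fin (suc (suc n))) i → inputNode {G = G} a ≡ input i ⇔ inject₁ (inject₁ i) ≡ a
  inputNode-input a i with toℕ a <? n
  ... | yes a<n = mk⇔ (λ { refl → Fin.toℕ-injective (trans (toℕ-inject₁² (fromℕ< a<n)) (Fin.toℕ-fromℕ< a<n)) })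
                      (λ { refl → cong input (Fin.toℕ-injective (trans (Fin.toℕ-fromℕ< a<n) (toℕ-inject₁² i))) })
  ... | no  a≮n = mk⇔ (λ ()) (λ { refl → contradiction (subst (_< n) (sym (toℕ-inject₁² i)) (Fin.toℕ<n i)) a≮n })

  inputNode-const : ∀ {G} (a : Fin (suc (suc n))) → inputNode {G = G} a ≡ const false ⇔ n ≤ toℕ a
  inputNode-const a with toℕ a <? n
  ... | yes a<n = mk⇔ (λ ()) (λ n≤a → contradiction a<n (≤⇒≯ n≤a))
  ... | no  a≮n = mk⇔ (λ _ → ≮⇒≥ a≮n) (λ _ → refl)

  ⊨-inputKind : ∀ i (g : Name k n) κ → kindNode κ g ≡ input i ⇔ inject₁ (inject₁ i) ∷ g ⊨ inputKindᶠ κ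
  ⊨-inputKind i g (input x) = mk⇔
    (λ e → from (⊨-≐ (inject₁ (inject₁ i) ∷ g) zero (suc x)) (to (inputNode-input _ i) e))
    (λ p → from (inputNode-input _ i) (to (⊨-≐ (inject₁ (inject₁ i) ∷ g) zero (suc x)) p))
  ⊨-inputKind i g (const _)      = false-⇔ (inject₁ (inject₁ i) ∷ g) λ ()
  ⊨-inputKind i g (not-gate _)   = false-⇔ (inject₁ (inject₁ i) ∷ g) λ ()
  ⊨-inputKind i g (and-gate _ _) = false-⇔ (inject₁ (inject₁ i) ∷ g) λ ()
  ⊨-inputKind i g (or-gate _ _)  = false-⇔ (inject₁ (inject₁ i) ∷ g) λ ()

  ⊨-constKind : ∀ b (g : Name k n) κ → kindNode κ g ≡ const b ⇔ g ⊨ constKindᶠ b κ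
  ⊨-constKind true  g (input x) = false-⇔ g input≢true
    where
    input≢true : inputNode (lookup g x) ≢ const true
    input≢true e with toℕ (lookup g x) <? n
    input≢true () | yes _
    input≢true () | no  _
  ⊨-constKind false g (input x) = mk⇔
    (λ e (b , c , p , q) → large (to (inputNode-const _) e) b c p q)
    (λ p → from (inputNode-const _) (≮⇒≥ λ x<n →
      p (inject₁ (fromℕ n) , fromℕ (suc n) ,
         <⇒≱ (subst (toℕ (lookup g x) <_) (sym (trans (Fin.toℕ-inject₁ (fromℕ n)) (Fin.toℕ-fromℕ n))) x<n) ,
         <⇒≱ (≤-reflexive (trans (cong suc (trans (Fin.toℕ-inject₁ (fromℕ n)) (Fin.toℕ-fromℕ n))) (sym (Fin.toℕ-fromℕ (suc n))))))))
    where
    large : n ≤ toℕ (lookup g x) → ∀ (b c : Fin (suc (suc n))) →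
            ¬ (toℕ b ≤ toℕ (lookup g x)) → ¬ (toℕ c ≤ toℕ b) → ⊥
    large n≤x b c b≰x c≰b = <⇒≱ (Fin.toℕ<n c) (≤-trans (s≤s (≤-trans (s≤s n≤x) (≰⇒> b≰x))) (≰⇒> c≰b))
  ⊨-constKind true  g (const true)  = true-⇔ g refl
  ⊨-constKind true  g (const false) = false-⇔ g λ ()
  ⊨-constKind false g (const true)  = false-⇔ g λ ()
  ⊨-constKind false g (const false) = true-⇔ g refl
  ⊨-constKind true  g (not-gate _)   = false-⇔ g λ ()
  ⊨-constKind false g (not-gate _)   = false-⇔ g λ ()
  ⊨-constKind true  g (and-gate _ _) = false-⇔ g λ ()
  ⊨-constKind false g (and-gate _ _) = false-⇔ g λ ()
  ⊨-constKind true  g (or-gate _ _)  = false-⇔ g λ ()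
  ⊨-constKind false g (or-gate _ _)  = false-⇔ g λ ()

  ⊨-notKind : ∀ (g h : Name k n) κ → kindNode κ g ≡ not-gate h ⇔ g Vec.++ h ⊨ notKindᶠ κ
  ⊨-notKind g h (not-gate S) = mk⇔ (λ { refl → to fits refl }) (λ p → cong not-gate (sym (from fits p)))
    where
    fits : h ≡ apply S g ⇔ g Vec.++ h ⊨ notKindᶠ (not-gate S)
    fits = ⊨-isApply S (Vec.lookup-++ˡ g h) (Vec.lookup-++ʳ g h)
  ⊨-notKind g h (input x) = false-⇔ (g Vec.++ h) input≢not
    where
    input≢not : inputNode (lookup g x) ≢ not-gate h
    input≢not e with toℕ (lookup g x) <? n
    input≢not () | yes _
    input≢not () | no  _
  ⊨-notKind g h (const _)      = false-⇔ (g Vec.++ h) λ ()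
  ⊨-notKind g h (and-gate _ _) = false-⇔ (g Vec.++ h) λ ()
  ⊨-notKind g h (or-gate _ _)  = false-⇔ (g Vec.++ h) λ ()

  ⊨-binary : ∀ (g h h′ : Name k n) S T →
             (h ≡ apply S g × h′ ≡ apply T g) ⇔ g Vec.++ (h Vec.++ h′) ⊨ binaryᶠ S T
  ⊨-binary g h h′ S T = mk⇔
    (λ (e , e′) → to fits e , to fits′ e′)
    (λ (p , p′) → from fits p , from fits′ p′)
    where
    fits : h ≡ apply S g ⇔ _
    fits = ⊨-isApply S (Vec.lookup-++ˡ g _) (λ i → trans (Vec.lookup-++ʳ g _ (i ↑ˡ k)) (Vec.lookup-++ˡ h h′ i))
    fits′ : h′ ≡ apply T g ⇔ _
    fits′ = ⊨-isApply T (Vec.lookup-++ˡ g _) (λ i → trans (Vec.lookup-++ʳ g _ (k ↑ʳ i)) (Vec.lookup-++ʳ h h′ i))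

  ⊨-andKind : ∀ (g h h′ : Name k n) κ → kindNode κ g ≡ and-gate h h′ ⇔ g Vec.++ (h Vec.++ h′) ⊨ andKindᶠ κ
  ⊨-andKind g h h′ (and-gate S T) = mk⇔
    (λ { refl → to (⊨-binary g h h′ S T) (refl , refl) })
    (λ p → let e , e′ = from (⊨-binary g h h′ S T) p in cong₂ and-gate (sym e) (sym e′))
  ⊨-andKind g h h′ (input x) = false-⇔ (g Vec.++ (h Vec.++ h′)) input≢and
    where
    input≢and : inputNode (lookup g x) ≢ and-gate h h′
    input≢and e with toℕ (lookup g x) <? n
    input≢and () | yes _
    input≢and () | no  _
  ⊨-andKind g h h′ (const _)     = false-⇔ (g Vec.++ (h Vec.++ h′)) λ ()
  ⊨-andKind g h h′ (not-gate _)  = false-⇔ (g Vec.++ (h Vec.++ h′)) λ ()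
  ⊨-andKind g h h′ (or-gate _ _) = false-⇔ (g Vec.++ (h Vec.++ h′)) λ ()

  ⊨-orKind : ∀ (g h h′ : Name k n) κ → kindNode κ g ≡ or-gate h h′ ⇔ g Vec.++ (h Vec.++ h′) ⊨ orKindᶠ κ
  ⊨-orKind g h h′ (or-gate S T) = mk⇔
    (λ { refl → to (⊨-binary g h h′ S T) (refl , refl) })
    (λ p → let e , e′ = from (⊨-binary g h h′ S T) p in cong₂ or-gate (sym e) (sym e′))
  ⊨-orKind g h h′ (input x) = false-⇔ (g Vec.++ (h Vec.++ h′)) input≢or
    where
    input≢or : inputNode (lookup g x) ≢ or-gate h h′
    input≢or e with toℕ (lookup g x) <? n
    input≢or () | yes _
    input≢or () | no  _
  ⊨-orKind g h h′ (const _)      = false-⇔ (g Vec.++ (h Vec.++ h′)) λ ()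
  ⊨-orKind g h h′ (not-gate _)   = false-⇔ (g Vec.++ (h Vec.++ h′)) λ ()
  ⊨-orKind g h h′ (and-gate _ _) = false-⇔ (g Vec.++ (h Vec.++ h′)) λ ()

treeFamily : ∀ {k} → Tree k → Substitution 0 k → Family k
treeFamily T S n = record { node = treeNode T ; output = apply S [] }

treeFamily-uniform : ∀ {k} (T : Tree k) (S : Substitution 0 k) → Uniform (treeFamily T S)
treeFamily-uniform {k} T S = record
  { inputᶠ     = treeᶠ suc inputKindᶠ T
  ; constᶠ     = λ b → treeᶠ id (constKindᶠ b) T
  ; notᶠ       = treeᶠ (_↑ˡ k) notKindᶠ T
  ; andᶠ       = treeᶠ (_↑ˡ (k + k)) andKindᶠ T
  ; orᶠ        = treeᶠ (_↑ˡ (k + k)) orKindᶠ T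
  ; outputᶠ    = isApplyᶠ S (λ ()) id
  ; input-def  = λ n i g → ⊨-tree {σ = suc} (λ _ → refl) (⊨-inputKind i g) T
  ; const-def  = λ n b g → ⊨-tree {σ = id} (λ _ → refl) (⊨-constKind b g) T
  ; not-def    = λ n g h → ⊨-tree (Vec.lookup-++ˡ g h) (⊨-notKind g h) T
  ; and-def    = λ n g h h′ → ⊨-tree (Vec.lookup-++ˡ g _) (⊨-andKind g h h′) T
  ; or-def     = λ n g h h′ → ⊨-tree (Vec.lookup-++ˡ g _) (⊨-orKind g h h′) T
  ; output-def = λ n g → mk⇔ (λ e → to (fits g) (sym e)) (λ p → sym (from (fits g) p))
  }
  where
  fits : ∀ {n} (g : Name k n) → g ≡ apply S [] ⇔ g ⊨ isApplyᶠ S (λ ()) id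
  fits g = ⊨-isApply S {τ = id} {ρ = g} {h = g} (λ ()) (λ _ → refl)

-- Paths through a layered graph

data Path {Q : Set} (R : ℕ → Q → Q → Set) : ℕ → ℕ → Q → Q → Set where
  []  : ∀ {a q} → Path R a a q q
  _∷_ : ∀ {a b q r s} → R a q r → Path R (suc a) b r s → Path R a b q s

path-≤ : ∀ {Q R a b} {q s : Q} → Path R a b q s → a ≤ b
path-≤ []      = ≤-refl
path-≤ (_ ∷ π) = <⇒≤ (path-≤ π)

_++ᵖ_ : ∀ {Q R a b c} {q r s : Q} → Path R a b q r → Path R b c r s → Path R a c q s
[]      ++ᵖ ϖ = ϖ
(e ∷ π) ++ᵖ ϖ = e ∷ (π ++ᵖ ϖ)

path-split : ∀ {Q R a b c} {q s : Q} → a ≤ b → b ≤ c → Path R a c q s →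
             ∃[ r ] Path R a b q r × Path R b c r s
path-split {a = a} {b} a≤b b≤c π with a ≟ b
... | yes refl = _ , [] , π
path-split a≤b b≤c []      | no a≢b = contradiction (≤-antisym a≤b b≤c) a≢b
path-split a≤b b≤c (e ∷ π) | no a≢b =
  let r , π₁ , π₂ = path-split (≤∧≢⇒< a≤b a≢b) b≤c π in r , e ∷ π₁ , π₂

path-single : ∀ {Q R a} {q s : Q} → Path R a (suc a) q s ⇔ R a q s
path-single = mk⇔ (λ { (e ∷ []) → e ; (e ∷ (_ ∷ π)) → contradiction (path-≤ π) 1+n≰n }) (λ e → e ∷ [])

-- Circuits refuting the existence of paths

evaluates-functional : ∀ {n G} (C : Circuit n G) {x ν b b′} → Evaluates C x ν b → Evaluates C x ν b′ → b ≡ b′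
evaluates-functional C (input i)      (input .i)       = refl
evaluates-functional C (const b)      (const .b)       = refl
evaluates-functional C (not-gate e)   (not-gate e′)    = cong not (evaluates-functional C e e′)
evaluates-functional C (and-gate e f) (and-gate e′ f′) = cong₂ _∧_ (evaluates-functional C e e′) (evaluates-functional C f f′)
evaluates-functional C (or-gate e f)  (or-gate e′ f′)  = cong₂ _∨_ (evaluates-functional C e e′) (evaluates-functional C f f′)

depth-mono : ∀ {n G} (C : Circuit n G) {d d′ ν} → d ≤ d′ → Depth≤ C d ν → Depth≤ C d′ ν
depth-mono C _        (input i)      = input i
depth-mono C _        (const b)      = const b
depth-mono C (s≤s le) (not-gate e)   = not-gate (depth-mono C le e)
depth-mono C (s≤s le) (and-gate e f) = and-gate (depth-mono C le e) (depth-mono C le f)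
depth-mono C (s≤s le) (or-gate e f)  = or-gate (depth-mono C le e) (depth-mono C le f)

module _ {n G} (C : Circuit n G) (x : Fin n → Bool) where

  open Circuit C using (node)

  -- The inverted polarity turns, by De Morgan, a choice between two possibilities into an and-gate
  -- and the joining of two paths into an or-gate; the output then decides the absence of a path
  -- without a final negation.
  record Refutes (d : ℕ) (ν : Node n G) (P : Set) : Set where
    constructor refutes
    field
      depth : Depth≤ C d ν
      {bit} : Bool
      evaluates : Evaluates C x ν bit
      correct   : bit ≡ false ⇔ P

  open Refutes

  refutes-map : ∀ {d ν P P′} → P ⇔ P′ → Refutes d ν P → Refutes d ν P′
  refutes-map e r = refutes (depth r) (evaluates r) (mk⇔ (to e ∘ to (correct r)) (from (correct r) ∘ from e))

  refutes-and : ∀ {d g h P P′} → Refutes d (node g) P → Refutes d (node h) P′ →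
                Refutes (suc d) (and-gate g h) (P ⊎ P′)
  refutes-and (refutes d {false} e c) (refutes d′ {b′} e′ c′) =
    refutes (and-gate d d′) (and-gate e e′) (mk⇔ (λ _ → inj₁ (to c refl)) (λ _ → refl))
  refutes-and (refutes d {true}  e c) (refutes d′ {b′} e′ c′) =
    refutes (and-gate d d′) (and-gate e e′) (mk⇔ (inj₂ ∘ to c′) [ (λ p → contradiction (from c p) λ ()) , from c′ ]′)

  refutes-or : ∀ {d g h P P′} → Refutes d (node g) P → Refutes d (node h) P′ →
               Refutes (suc d) (or-gate g h) (P × P′)
  refutes-or (refutes d {false} e c) (refutes d′ {b′} e′ c′) =
    refutes (or-gate d d′) (or-gate e e′) (mk⇔ (λ b → to c refl , to c′ b) (from c′ ∘ proj₂))
  refutes-or (refutes d {true}  e c) (refutes d′ {b′} e′ c′) =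
    refutes (or-gate d d′) (or-gate e e′) (mk⇔ (λ ()) (λ (p , _) → contradiction (from c p) λ ()))

  refutes-mono : ∀ {d d′ ν P} → d ≤ d′ → Refutes d ν P → Refutes d′ ν P
  refutes-mono le r = refutes (depth-mono C le (depth r)) (evaluates r) (correct r)

-- Letters, tables of bits, and halving

letterAt : ∀ {n} → (Fin n → Bool) → ℕ → Maybe Bool
letterAt {zero}  x _       = nothing
letterAt {suc n} x zero    = just (x zero)
letterAt {suc n} x (suc a) = letterAt (x ∘ suc) a

letterAt-< : ∀ {n} (x : Fin n → Bool) {a} (a<n : a < n) → letterAt x a ≡ just (x (fromℕ< a<n))
letterAt-< {suc n} x {zero}  _         = refl
letterAt-< {suc n} x {suc a} (s≤s a<n) = letterAt-< (x ∘ suc) a<n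

letterAt-≥ : ∀ {n} (x : Fin n → Bool) {a} → n ≤ a → letterAt x a ≡ nothing
letterAt-≥ {zero}  x         _         = refl
letterAt-≥ {suc n} x {suc a} (s≤s n≤a) = letterAt-≥ (x ∘ suc) n≤a

nonzero : ∀ {n} → Fin (suc n) → Bool
nonzero zero    = false
nonzero (suc _) = true

not-false : ∀ b → not b ≡ false ⇔ b ≡ true
not-false false = mk⇔ (λ ()) (λ ())
not-false true  = mk⇔ (λ _ → refl) (λ _ → refl)

nonzero-true : ∀ {n} {a : Fin (suc n)} → a ≢ zero → nonzero a ≡ true
nonzero-true {a = zero}  a≢0 = contradiction refl a≢0
nonzero-true {a = suc _} _   = refl

nonzero-bit : ∀ {k n} t (g : Name k n) → nonzero (value (bitᵗ t) g) ≡ t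
nonzero-bit false g = refl
nonzero-bit true  g = refl

-- Unfolds a table over `c` bits into tests of single coordinates. As `c` is fixed, the tree is
-- independent of `n`; any nonzero coordinate counts as a true bit.
branch : ∀ {k} c → (Fin c → Fin k) → (Vec Bool c → Tree k) → Tree k
branch zero    v T = T []
branch (suc c) v T = ite (isZeroᶠ (v zero)) (branch c (v ∘ suc) (T ∘ (false ∷_))) (branch c (v ∘ suc) (T ∘ (true ∷_)))

branch-node : ∀ {k n} c (v : Fin c → Fin k) T (g : Name k n) →
              treeNode (branch c v T) g ≡ treeNode (T (tabulate (nonzero ∘ lookup g ∘ v))) g
branch-node zero    v T g = refl
branch-node (suc c) v T g with g ⊨? isZeroᶠ (v zero)
... | yes p rewrite to (⊨-isZero g (v zero)) p = branch-node c (v ∘ suc) _ g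
... | no ¬p rewrite nonzero-true (¬p ∘ from (⊨-isZero g (v zero))) = branch-node c (v ∘ suc) _ g

ite-yes : ∀ {k n} (φ : Formula k) T U (g : Name k n) → g ⊨ φ → treeNode (ite φ T U) g ≡ treeNode T g
ite-yes φ T U g p with g ⊨? φ
... | yes _ = refl
... | no ¬p = contradiction p ¬p

ite-no : ∀ {k n} (φ : Formula k) T U (g : Name k n) → ¬ (g ⊨ φ) → treeNode (ite φ T U) g ≡ treeNode U g
ite-no φ T U g ¬p with g ⊨? φ
... | yes p = contradiction p ¬p
... | no _  = refl

half-bounds : ∀ {e} → 2 ≤ e → 0 < ⌊ e /2⌋ × ⌊ e /2⌋ < e
half-bounds {suc (suc e)} (s≤s (s≤s _)) = s≤s z≤n , ⌊n/2⌋<n (suc e)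

n<2^1+⌊log₂n⌋ : ∀ n → n < 2 ^ suc ⌊log₂ n ⌋
n<2^1+⌊log₂n⌋ n = ≰⇒> λ 2^≤n →
  1+n≰n (subst (_≤ ⌊log₂ n ⌋) (⌊log₂[2^n]⌋≡n (suc ⌊log₂ n ⌋)) (⌊log₂⌋-mono-≤ 2^≤n))

midpoint-bounds : ∀ {a b} → suc a < b → a < midpoint a b × midpoint a b < b
midpoint-bounds {a} {b} 1+a<b =
  let 0<h , h<e = half-bounds (m+n≤o⇒m≤o∸n 2 1+a<b) in
  subst (_< midpoint a b) (+-identityʳ a) (+-monoʳ-< a 0<h) ,
  subst (midpoint a b <_) (m+[n∸m]≡n (<⇒≤ (<-trans (n<1+n a) 1+a<b))) (+-monoʳ-< a h<e)

-- The two parts are half the length rounded down and up; even the rounded-up half of a length at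
-- most `w + w` is at most `w`.
midpoint-halves : ∀ {a b} w → b ≤ a + (w + w) → midpoint a b ≤ a + w × b ≤ midpoint a b + w
midpoint-halves {a} {b} w le =
  +-monoʳ-≤ a (subst (⌊ b ∸ a /2⌋ ≤_) (sym (n≡⌊n+n/2⌋ w)) (⌊n/2⌋-mono e≤2w)) , upper
  where
  e≤2w : b ∸ a ≤ w + w
  e≤2w = m≤n+o⇒m∸n≤o b a le
  upper : b ≤ midpoint a b + w
  upper = begin
    b                                       ≤⟨ m≤n+m∸n b a ⟩
    a + (b ∸ a)                             ≡⟨ cong (a +_) (sym (⌊n/2⌋+⌈n/2⌉≡n (b ∸ a))) ⟩
    a + (⌊ b ∸ a /2⌋ + ⌈ b ∸ a /2⌉)         ≡⟨ sym (+-assoc a _ _) ⟩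
    midpoint a b + ⌈ b ∸ a /2⌉              ≤⟨ +-monoʳ-≤ (midpoint a b) (⌈n/2⌉-mono e≤2w) ⟩
    midpoint a b + ⌈ w + w /2⌉              ≡⟨ cong (midpoint a b +_) (sym (n≡⌈n+n/2⌉ w)) ⟩
    midpoint a b + w                        ∎
    where open ≤-Reasoning

-- The divide-and-conquer circuit for paths

module PathCircuit (c : ℕ) (δ : Bool → Vec Bool c → Vec Bool c → Bool) (end : Vec Bool c → Bool) where

  State : Set
  State = Vec Bool c

  -- `nothing` acts as an end marker at position `n`: testing for a final state is one more step.
  -- This step leaves its target free, so a path with one fixed target stands for runs ending in any
  -- final state.
  StepAt : Maybe Bool → State → State → Set
  StepAt nothing  q _ = end q ≡ true
  StepAt (just b) q r = δ b q r ≡ true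

  -- The coordinates of a gate name.  If tag is zero and lo < hi, the gate is
  -- false iff there is a path from src at position lo to tgt at position hi
  -- that passes the midpoint in a state agreeing with mid on the bits
  -- recorded in set; the bits not in set are still to be guessed.
  data Var : Set where
    tag lo hi       : Var
    src tgt set mid : Fin c → Var

  arity : ℕ
  arity = 3 + 4 * c

  index : Var → Fin arity
  index tag     = zero
  index lo      = suc zero
  index hi      = suc (suc zero)
  index (src j) = 3 ↑ʳ combine {4} zero j
  index (tgt j) = 3 ↑ʳ combine {4} (suc zero) j
  index (set j) = 3 ↑ʳ combine {4} (suc (suc zero)) j
  index (mid j) = 3 ↑ʳ combine {4} (suc (suc (suc zero))) j

  field-var : Fin 4 × Fin c → Var
  field-var (zero                 , j) = src j
  field-var (suc zero             , j) = tgt j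
  field-var (suc (suc zero)       , j) = set j
  field-var (suc (suc (suc zero)) , j) = mid j

  view : Fin arity → Var
  view zero                = tag
  view (suc zero)          = lo
  view (suc (suc zero))    = hi
  view (suc (suc (suc i))) = field-var (remQuot c i)

  view-index : ∀ v → view (index v) ≡ v
  view-index tag     = refl
  view-index lo      = refl
  view-index hi      = refl
  view-index (src j) = cong field-var (Fin.remQuot-combine {4} zero j)
  view-index (tgt j) = cong field-var (Fin.remQuot-combine {4} (suc zero) j)
  view-index (set j) = cong field-var (Fin.remQuot-combine {4} (suc (suc zero)) j)
  view-index (mid j) = cong field-var (Fin.remQuot-combine {4} (suc (suc (suc zero))) j)

  Assignment : ℕ → Set
  Assignment k = Var → Term k

  subst-of : ∀ {k} → Assignment k → Substitution k arity
  subst-of S = S ∘ view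

  keep : Var → Term arity
  keep v = var (index v)

  -- A negated literal needs a gate that carries the input bit; names with nonzero tag serve for
  -- this. `left` and `right` clear `set`, so that each half guesses a midpoint state of its own.
  readBit left right : Assignment arity
  readBit tag = oneᵗ
  readBit v   = keep v
  left lo      = keep lo
  left hi      = midᵗ (index lo) (index hi)
  left (src j) = keep (src j)
  left (tgt j) = keep (mid j)
  left _       = zeroᵗ
  right lo      = midᵗ (index lo) (index hi)
  right hi      = keep hi
  right (src j) = keep (mid j)
  right (tgt j) = keep (tgt j)
  right _       = zeroᵗ

  guess : Fin c → Bool → Assignment arity
  guess j b (set i) = if does (i Fin.≟ j) then oneᵗ else keep (set i)
  guess j b (mid i) = if does (i Fin.≟ j) then bitᵗ b else keep (mid i)
  guess j b v       = keep v

  root : Assignment 0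
  root hi = maxᵗ
  root _  = zeroᵗ

  -- u and v are the values wanted for a false and a true bit at lo.
  literal : Bool → Bool → Kind arity
  literal false false = const false
  literal false true  = input (index lo)
  literal true  false = not-gate (subst-of readBit)
  literal true  true  = const true

  endTree letterTree stepTree : Tree arity
  endTree    = branch c (index ∘ src) λ q → leaf (const (not (end q)))
  letterTree = branch c (index ∘ src) λ q → branch c (index ∘ tgt) λ r →
    leaf (literal (not (δ false q r)) (not (δ true q r)))
  stepTree   = ite (isMaxᶠ (index hi))    endTree letterTree

  guessTree : Fin c → Tree arity
  guessTree j = leaf (and-gate (subst-of (guess j false)) (subst-of (guess j true)))

  -- Guessing one bit per gate keeps the fan-in at two: the first bit not yet set is guessed next,
  -- and the halves are combined once all `c` bits are set.
  splitTree : List (Fin c) → Tree arity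
  splitTree []       = leaf (or-gate (subst-of left) (subst-of right))
  splitTree (j ∷ js) = ite (isZeroᶠ (index (set j))) (guessTree j) (splitTree js)

  pathTree intervalTree tree : Tree arity
  pathTree     = ite (isSucᶠ (index lo) (index hi)) stepTree (splitTree (List.allFin c))
  intervalTree = ite (index lo <ᶠ index hi) pathTree (leaf (const true))
  tree         = ite (isZeroᶠ (index tag)) intervalTree (leaf (input (index lo)))

  family : Family arity
  family = treeFamily tree (subst-of root)

  module _ {n : ℕ} where

    at : Name arity n → Var → Fin (suc (suc n))
    at g v = lookup g (index v)

    bits : Name arity n → (Fin c → Var) → State
    bits g v = tabulate (nonzero ∘ at g ∘ v)

    at-apply : ∀ {k} (S : Assignment k) (g : Name k n) v → at (apply (subst-of S) g) v ≡ value (S v) g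
    at-apply S g v = trans (Vec.lookup∘tabulate (λ i → value (S (view i)) g) (index v)) (cong (λ u → value (S u) g) (view-index v))

    bits-apply : ∀ {k} (S : Assignment k) (g : Name k n) v → bits (apply (subst-of S) g) v ≡ tabulate (λ j → nonzero (value (S (v j)) g))
    bits-apply S g v = Vec.tabulate-cong λ j → cong nonzero (at-apply S g (v j))

    node-input : ∀ g → at g tag ≢ zero → treeNode tree g ≡ inputNode (at g lo)
    node-input g tag≢0 =
      ite-no (isZeroᶠ (index tag)) intervalTree (leaf (input (index lo))) g (tag≢0 ∘ to (⊨-isZero g (index tag)))

    node-interval : ∀ g → at g tag ≡ zero → treeNode tree g ≡ treeNode intervalTree g
    node-interval g tag≡0 =
      ite-yes (isZeroᶠ (index tag)) intervalTree (leaf (input (index lo))) g (from (⊨-isZero g (index tag)) tag≡0)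

    node-empty : ∀ g → at g tag ≡ zero → ¬ (toℕ (at g lo) < toℕ (at g hi)) → treeNode tree g ≡ const true
    node-empty g tag≡0 lo≮hi = trans (node-interval g tag≡0)
      (ite-no (index lo <ᶠ index hi) pathTree (leaf (const true)) g (lo≮hi ∘ to (⊨-< g (index lo) (index hi))))

    node-path : ∀ g → at g tag ≡ zero → toℕ (at g lo) < toℕ (at g hi) → treeNode tree g ≡ treeNode pathTree g
    node-path g tag≡0 lo<hi = trans (node-interval g tag≡0)
      (ite-yes (index lo <ᶠ index hi) pathTree (leaf (const true)) g (from (⊨-< g (index lo) (index hi)) lo<hi))

    -- `set` and `mid` are left open because they vary while the midpoint state is being guessed and
    -- the rest of the name stays fixed.
    record At (g : Name arity n) (a b : ℕ) (q s : State) : Set where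
      field
        tag≡0 : at g tag ≡ zero
        lo≡   : toℕ (at g lo) ≡ a
        hi≡   : toℕ (at g hi) ≡ b
        src≡  : bits g src ≡ q
        tgt≡  : bits g tgt ≡ s

    open At

    Unset : Name arity n → Set
    Unset g = ∀ j → at g (set j) ≡ zero

    Agrees : Name arity n → State → Set
    Agrees g r = ∀ j → at g (set j) ≢ zero → lookup r j ≡ nonzero (at g (mid j))

    at-guess : ∀ {g a b q s} j t → At g a b q s → At (apply (subst-of (guess j t)) g) a b q s
    at-guess {g} j t p = record
      { tag≡0 = trans (at-apply (guess j t) g tag) (tag≡0 p)
      ; lo≡   = trans (cong toℕ (at-apply (guess j t) g lo)) (lo≡ p)
      ; hi≡   = trans (cong toℕ (at-apply (guess j t) g hi)) (hi≡ p)
      ; src≡  = trans (bits-apply (guess j t) g src) (src≡ p)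
      ; tgt≡  = trans (bits-apply (guess j t) g tgt) (tgt≡ p)
      }

    at-left : ∀ {g a b q s} → At g a b q s → At (apply (subst-of left) g) a (midpoint a b) q (bits g mid)
    at-left {g} p = record
      { tag≡0 = at-apply left g tag
      ; lo≡   = trans (cong toℕ (at-apply left g lo)) (lo≡ p)
      ; hi≡   = trans (cong toℕ (at-apply left g hi))
                      (trans (toℕ-midpointᶠ (at g lo) (at g hi)) (cong₂ midpoint (lo≡ p) (hi≡ p)))
      ; src≡  = trans (bits-apply left g src) (src≡ p)
      ; tgt≡  = bits-apply left g tgt
      }

    at-right : ∀ {g a b q s} → At g a b q s → At (apply (subst-of right) g) (midpoint a b) b (bits g mid) s
    at-right {g} p = record
      { tag≡0 = at-apply right g tag
      ; lo≡   = trans (cong toℕ (at-apply right g lo))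
                      (trans (toℕ-midpointᶠ (at g lo) (at g hi)) (cong₂ midpoint (lo≡ p) (hi≡ p)))
      ; hi≡   = trans (cong toℕ (at-apply right g hi)) (hi≡ p)
      ; src≡  = bits-apply right g src
      ; tgt≡  = trans (bits-apply right g tgt) (tgt≡ p)
      }

    module _ (x : Fin n → Bool) where

      private
        C : Circuit n (Name arity n)
        C = family n

      R : ℕ → State → State → Set
      R a = StepAt (letterAt x a)

      input-evaluates : ∀ {g a} → toℕ (at g lo) ≡ a → (a<n : a < n) →
                        Depth≤ C 0 (kindNode (input (index lo)) g) ×
                        Evaluates C x (kindNode (input (index lo)) g) (x (fromℕ< a<n))
      input-evaluates {g} refl a<n with toℕ (at g lo) <? n
      ... | yes _  = input _ , input _
      ... | no a≮n = contradiction a<n a≮n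

      literal-evaluates : ∀ {g a} u v → toℕ (at g lo) ≡ a → (a<n : a < n) →
                          Depth≤ C 1 (kindNode (literal u v) g) ×
                          Evaluates C x (kindNode (literal u v) g) (if x (fromℕ< a<n) then v else u)
      literal-evaluates false false e a<n with x (fromℕ< a<n)
      ... | false = const _ , const _
      ... | true  = const _ , const _
      literal-evaluates true true e a<n with x (fromℕ< a<n)
      ... | false = const _ , const _
      ... | true  = const _ , const _
      literal-evaluates {g} false true e a<n with x (fromℕ< a<n) | input-evaluates {g} e a<n
      ... | false | p , q = depth-mono C z≤n p , q
      ... | true  | p , q = depth-mono C z≤n p , q
      literal-evaluates {g} true false e a<n
        with x (fromℕ< a<n) | input-evaluates {apply (subst-of readBit) g} (trans (cong toℕ (at-apply readBit g lo)) e) a<n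
      ... | t | p , q = not-gate (subst (Depth≤ C 0) (sym reads) p) , subst (Evaluates C x _) (not≡if t) (not-gate (subst (λ ν → Evaluates C x ν t) (sym reads) q))
        where
        not≡if : ∀ t → not t ≡ (if t then false else true)
        not≡if false = refl
        not≡if true  = refl
        h : Name arity n
        h = apply (subst-of readBit) g
        reads : treeNode tree h ≡ kindNode (input (index lo)) h
        reads = node-input h λ z → contradiction (trans (sym z) (at-apply readBit g tag)) λ ()

      step-refutes : ∀ {g a q s} → At g a (suc a) q s → Refutes C x 1 (treeNode stepTree g) (R a q s)
      step-refutes {g} {a} {q} {s} p with a <? n
      ... | no a≮n = subst₂ (Refutes C x 1) (sym node≡) (cong (λ m → StepAt m q s) (sym (letterAt-≥ x (≮⇒≥ a≮n))))
                       (refutes (const _) (const _) (not-false (end q)))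
        where
        hi-max : toℕ (at g hi) ≡ suc n
        hi-max = ≤-antisym (Fin.toℕ≤pred[n] (at g hi)) (subst (suc n ≤_) (sym (hi≡ p)) (s≤s (≮⇒≥ a≮n)))
        node≡ : treeNode stepTree g ≡ const (not (end q))
        node≡ = trans (ite-yes (isMaxᶠ (index hi)) endTree letterTree g (from (⊨-isMax g (index hi)) hi-max))
                  (trans (branch-node c (index ∘ src) (λ q → leaf (const (not (end q)))) g) (cong (λ q → const (not (end q))) (src≡ p)))
      ... | yes a<n = subst₂ (Refutes C x 1) (sym node≡) (cong (λ m → StepAt m q s) (sym (letterAt-< x a<n)))
                        (let d , e = literal-evaluates (not (δ false q s)) (not (δ true q s)) (lo≡ p) a<n in
                         refutes d e (literal-correct (λ b → δ b q s) (x (fromℕ< a<n))))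
        where
        literal-correct : ∀ (f : Bool → Bool) t → (if t then not (f true) else not (f false)) ≡ false ⇔ f t ≡ true
        literal-correct f true  = not-false (f true)
        literal-correct f false = not-false (f false)
        K : State → State → Kind arity
        K q s = literal (not (δ false q s)) (not (δ true q s))
        hi-not-max : ¬ (g ⊨ isMaxᶠ (index hi))
        hi-not-max m = <⇒≢ a<n (suc-injective (trans (sym (hi≡ p)) (to (⊨-isMax g (index hi)) m)))
        node≡ : treeNode stepTree g ≡ kindNode (K q s) g
        node≡ = trans (ite-no (isMaxᶠ (index hi)) endTree letterTree g hi-not-max)
                  (trans (branch-node c (index ∘ src) (λ q → branch c (index ∘ tgt) λ r → leaf (K q r)) g)
                  (trans (branch-node c (index ∘ tgt) (λ r → leaf (K (bits g src) r)) g)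
                         (cong₂ (λ q r → kindNode (K q r) g) (src≡ p) (tgt≡ p))))

      Halves : Name arity n → ℕ → ℕ → State → State → Set
      Halves g a b q s = ∃[ r ] Agrees g r × Path R a (midpoint a b) q r × Path R (midpoint a b) b r s

      agrees-guess : ∀ {g j} r t → at g (set j) ≡ zero →
                     (lookup r j ≡ t × Agrees g r) ⇔ Agrees (apply (subst-of (guess j t)) g) r
      agrees-guess {g} {j} r t unset = mk⇔ right′ left′
        where
        h : Name arity n
        h = apply (subst-of (guess j t)) g
        right′ : lookup r j ≡ t × Agrees g r → Agrees h r
        right′ (e , ag) i set≢0 with i Fin.≟ j | at-apply (guess j t) g (set i) | at-apply (guess j t) g (mid i)
        ... | yes refl | _ | m = trans e (sym (trans (cong nonzero m) (nonzero-bit t g)))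
        ... | no _     | s | m = trans (ag i (set≢0 ∘ trans s)) (cong nonzero (sym m))
        left′ : Agrees h r → lookup r j ≡ t × Agrees g r
        left′ ag = guessed , rest
          where
          guessed : lookup r j ≡ t
          guessed with j Fin.≟ j | at-apply (guess j t) g (set j) | at-apply (guess j t) g (mid j) | ag j
          ... | yes _  | s | m | ag = trans (ag λ z → contradiction (trans (sym z) s) λ ()) (trans (cong nonzero m) (nonzero-bit t g))
          ... | no j≢j | _ | _ | _  = contradiction refl j≢j
          rest : Agrees g r
          rest i set≢0 with i Fin.≟ j | at-apply (guess j t) g (set i) | at-apply (guess j t) g (mid i) | ag i
          ... | yes refl | _ | _ | _  = contradiction unset set≢0
          ... | no _     | s | m | ag = trans (ag (set≢0 ∘ trans (sym s))) (cong nonzero m)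

      -- The child of a guess starts again at the root of the decision tree, with the full list of
      -- bits. Passing over those already set brings it back to the list on which the induction of
      -- `split-refutes` runs.
      skip : ∀ {g done js} → All (λ j → at g (set j) ≢ zero) done →
             treeNode (splitTree (done List.++ js)) g ≡ treeNode (splitTree js) g
      skip           []       = refl
      skip {g} {j ∷ done} {js} (p ∷ ps) = trans (ite-no (isZeroᶠ (index (set j))) (guessTree j) (splitTree (done List.++ js)) g (p ∘ to (⊨-isZero g (index (set j))))) (skip ps)

      node-split : ∀ {g a b q s} → At g a b q s → suc a < b →
                   treeNode tree g ≡ treeNode (splitTree (List.allFin c)) g
      node-split {g} p 1+a<b = trans
        (node-path g (tag≡0 p) (subst₂ _<_ (sym (lo≡ p)) (sym (hi≡ p)) (<-trans (n<1+n _) 1+a<b)))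
        (ite-no (isSucᶠ (index lo) (index hi)) stepTree (splitTree (List.allFin c)) g λ e →
          <⇒≢ 1+a<b (trans (cong suc (sym (lo≡ p))) (trans (to (⊨-isSuc g (index lo) (index hi)) e) (hi≡ p))))

      -- The depth bound is needed for all names, including those with part of the midpoint state
      -- already set. Such a gate may see only the paths that agree with this part, so `P` is tied
      -- to paths for unset names only.
      Interval : ℕ → Name arity n → ℕ → ℕ → State → State → Set₁
      Interval d g a b q s = Σ[ P ∈ Set ] Refutes C x d (treeNode tree g) P × (Unset g → P ⇔ Path R a b q s)

      guess-set : ∀ {g j i t} → at g (set i) ≢ zero → at (apply (subst-of (guess j t)) g) (set i) ≢ zero
      guess-set {g} {j} {i} {t} p e with i Fin.≟ j | at-apply (guess j t) g (set i)
      ... | yes _ | e′ = contradiction (trans (sym e) e′) λ ()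
      ... | no _  | e′ = p (trans (sym e′) e)

      guess-set-self : ∀ {g j t} → at (apply (subst-of (guess j t)) g) (set j) ≢ zero
      guess-set-self {g} {j} {t} e with j Fin.≟ j | at-apply (guess j t) g (set j)
      ... | yes _ | e′ = contradiction (trans (sym e) e′) λ ()
      ... | no j≢j | _ = j≢j refl

      -- Every bit in `js` costs at most one and-gate and the final or-gate one more, whence
      -- `length js + suc d`. The halves enter as hypotheses, which leaves the induction on interval
      -- length to `interval`.
      split-refutes : ∀ {d a b q s} → suc a < b →
                      (∀ {g r} → At g a (midpoint a b) q r → Interval d g a (midpoint a b) q r) →
                      (∀ {g r} → At g (midpoint a b) b r s → Interval d g (midpoint a b) b r s) →
                      ∀ done js {g} → done List.++ js ≡ List.allFin c → All (λ j → at g (set j) ≢ zero) done → At g a b q s →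
                      Refutes C x (length js + suc d) (treeNode (splitTree js) g) (Halves g a b q s)
      split-refutes {d} {a} {b} {q} {s} _ lower upper done [] {g} eq all-set p =
        refutes-map C x (mk⇔ join′ split′) (refutes-or C x (proj₁ (proj₂ l)) (proj₁ (proj₂ u)))
        where
        gl gu : Name arity n
        gl = apply (subst-of left) g
        gu = apply (subst-of right) g
        l : Interval d gl a (midpoint a b) q (bits g mid)
        l = lower (at-left p)
        u : Interval d gu (midpoint a b) b (bits g mid) s
        u = upper (at-right p)
        l-path = proj₂ (proj₂ l) (λ j → at-apply left g (set j))
        u-path = proj₂ (proj₂ u) (λ j → at-apply right g (set j))
        set≢0 : ∀ j → at g (set j) ≢ zero
        set≢0 = All.tabulate⁻ (subst (All _) (trans (sym (List.++-identityʳ done)) eq) all-set)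
        join′ : proj₁ l × proj₁ u → Halves g a b q s
        join′ (π , ϖ) = bits g mid , (λ j _ → Vec.lookup∘tabulate _ j) , to l-path π , to u-path ϖ
        split′ : Halves g a b q s → proj₁ l × proj₁ u
        -- With all bits set, the recorded state is the only one that agrees with the name.
        split′ (r , ag , π , ϖ) with refl ← trans (sym (Vec.tabulate∘lookup r)) (Vec.tabulate-cong λ j → ag j (set≢0 j)) =
          from l-path π , from u-path ϖ
      split-refutes {d} {a} {b} {q} {s} a<b lower upper done (j ∷ js) {g} eq all-set p with at g (set j) Fin.≟ zero
      -- A bit that is already set costs no gate; the bound counts it all the same.
      ... | no set≢0 = subst (λ ν → Refutes C x (suc (length js + suc d)) ν (Halves g a b q s))
              (sym (ite-no (isZeroᶠ (index (set j))) (guessTree j) (splitTree js) g (set≢0 ∘ to (⊨-isZero g (index (set j))))))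
              (refutes-mono C x (n≤1+n _)
                (split-refutes a<b lower upper (done List.∷ʳ j) js (trans (List.∷ʳ-++ done j js) eq) (All.∷ʳ⁺ all-set set≢0) p))
      ... | yes set≡0 = subst (λ ν → Refutes C x (suc (length js + suc d)) ν (Halves g a b q s))
              (sym (ite-yes (isZeroᶠ (index (set j))) (guessTree j) (splitTree js) g (from (⊨-isZero g (index (set j))) set≡0)))
              (refutes-map C x (mk⇔ [ forget false , forget true ]′ choose)
                (refutes-and C x (child false) (child true)))
        where
        h : Bool → Name arity n
        h t = apply (subst-of (guess j t)) g
        child : ∀ t → Refutes C x (length js + suc d) (treeNode tree (h t)) (Halves (h t) a b q s)
        child t = subst (λ ν → Refutes C x (length js + suc d) ν (Halves (h t) a b q s))
          (sym (trans (node-split (at-guess j t p) a<b)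
            (trans (cong (λ js → treeNode (splitTree js) (h t)) (trans (sym eq) (sym (List.∷ʳ-++ done j js)))) (skip set′))))
          (split-refutes a<b lower upper (done List.∷ʳ j) js (trans (List.∷ʳ-++ done j js) eq) set′ (at-guess j t p))
          where
          set′ : All (λ i → at (h t) (set i) ≢ zero) (done List.∷ʳ j)
          set′ = All.∷ʳ⁺ (All.map guess-set all-set) guess-set-self
        forget : ∀ t → Halves (h t) a b q s → Halves g a b q s
        forget t (r , ag , π , ϖ) = r , proj₂ (from (agrees-guess r t set≡0) ag) , π , ϖ
        choose : Halves g a b q s → Halves (h false) a b q s ⊎ Halves (h true) a b q s
        choose (r , ag , π , ϖ) with lookup r j in e
        ... | false = inj₁ (r , to (agrees-guess r false set≡0) (e , ag) , π , ϖ)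
        ... | true  = inj₂ (r , to (agrees-guess r true set≡0) (e , ag) , π , ϖ)

      -- A halving costs `c` guesses and one combination; the final 1 is a possible negation at a
      -- unit interval.
      depthBound : ℕ → ℕ
      depthBound d = suc c * d + 1

      interval : ∀ d {g a b q s} → At g a b q s → a < b → b ≤ a + 2 ^ d → Interval (depthBound d) g a b q s
      interval d {g} {a} {b} {q} {s} p a<b b≤ with suc a ≟ b
      ... | yes refl = R a q s , subst (λ ν → Refutes C x (depthBound d) ν (R a q s)) (sym node≡)
                         (refutes-mono C x (m≤n+m 1 (suc c * d)) (step-refutes p)) ,
                       λ _ → mk⇔ (from path-single) (to path-single)
        where
        node≡ : treeNode tree g ≡ treeNode stepTree g
        node≡ = trans
          (node-path g (tag≡0 p) (subst₂ _<_ (sym (lo≡ p)) (sym (hi≡ p)) a<b))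
          (ite-yes (isSucᶠ (index lo) (index hi)) stepTree (splitTree (List.allFin c)) g
            (from (⊨-isSuc g (index lo) (index hi)) (trans (cong suc (lo≡ p)) (sym (hi≡ p)))))
      interval zero    {a = a} {b} p a<b b≤ | no 1+a≢b =
        contradiction (≤-antisym a<b (subst (b ≤_) (+-comm a 1) b≤)) 1+a≢b
      interval (suc d) {g} {a} {b} {q} {s} p a<b b≤ | no 1+a≢b =
        Halves g a b q s , subst (λ ν → Refutes C x (depthBound (suc d)) ν (Halves g a b q s)) (sym (node-split p 1+a<b))
          (refutes-mono C x (≤-reflexive depth≡)
            (split-refutes 1+a<b
              (λ p′ → interval d p′ (proj₁ m-bounds) (proj₁ m-halves))
              (λ p′ → interval d p′ (proj₂ m-bounds) (proj₂ m-halves))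
              [] (List.allFin c) refl [] p)) ,
        λ unset → mk⇔ (λ (_ , _ , π , ϖ) → π ++ᵖ ϖ)
          (λ π → let r , π₁ , π₂ = path-split (<⇒≤ (proj₁ m-bounds)) (<⇒≤ (proj₂ m-bounds)) π
                 in r , (λ j set≢0 → contradiction (unset j) set≢0) , π₁ , π₂)
        where
        1+a<b : suc a < b
        1+a<b = ≤∧≢⇒< a<b 1+a≢b
        m-bounds : a < midpoint a b × midpoint a b < b
        m-bounds = midpoint-bounds 1+a<b
        m-halves : midpoint a b ≤ a + 2 ^ d × b ≤ midpoint a b + 2 ^ d
        m-halves = midpoint-halves (2 ^ d) (subst (λ w → b ≤ a + (2 ^ d + w)) (+-identityʳ (2 ^ d)) b≤)
        depth≡ : length (List.allFin c) + suc (depthBound d) ≡ depthBound (suc d)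
        depth≡ = begin
          length (List.allFin c) + suc (suc c * d + 1) ≡⟨ cong (_+ suc (suc c * d + 1)) (List.length-tabulate id) ⟩
          c + suc (suc c * d + 1)                      ≡⟨ +-suc c _ ⟩
          suc c + (suc c * d + 1)                      ≡⟨ sym (+-assoc (suc c) (suc c * d) 1) ⟩
          (suc c + suc c * d) + 1                      ≡⟨ cong (_+ 1) (sym (*-suc (suc c) d)) ⟩
          suc c * suc d + 1                            ∎
          where open ≡-Reasoning

      accepts-¬path : Accepts C x ⇔ (¬ Path R 0 (suc n) (replicate c false) (replicate c false))
      accepts-¬path = mk⇔
        (λ acc π → contradiction (trans (evaluates-functional C acc (evaluates refuted)) (from (correct refuted) (from path π))) λ ())
        rejected
        where
        open Refutes
        root-name : Name arity n
        root-name = apply (subst-of root) []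
        replicated : ∀ (v : Fin c → Var) → (∀ j → at root-name (v j) ≡ zero) → bits root-name v ≡ replicate c false
        replicated v e = trans (Vec.tabulate-cong λ j → cong nonzero (e j)) (sym (replicate-tabulate c))
          where
          replicate-tabulate : ∀ c → replicate c false ≡ tabulate {n = c} (λ _ → false)
          replicate-tabulate zero    = refl
          replicate-tabulate (suc c) = cong (false ∷_) (replicate-tabulate c)
        at-root : At root-name 0 (suc n) (replicate c false) (replicate c false)
        at-root = record
          { tag≡0 = at-apply root [] tag
          ; lo≡   = cong toℕ (at-apply root [] lo)
          ; hi≡   = trans (cong toℕ (at-apply root [] hi)) (Fin.toℕ-fromℕ (suc n))
          ; src≡  = replicated src (λ j → at-apply root [] (src j))
          ; tgt≡  = replicated tgt (λ j → at-apply root [] (tgt j))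
          }
        whole : Interval (depthBound (suc ⌊log₂ n ⌋)) root-name 0 (suc n) (replicate c false) (replicate c false)
        -- The end step makes the path `n + 1` long, which is exactly what the strict bound on `n`
        -- allows.
        whole = interval (suc ⌊log₂ n ⌋) at-root (s≤s z≤n) (n<2^1+⌊log₂n⌋ n)
        refuted : Refutes C x (depthBound (suc ⌊log₂ n ⌋)) (treeNode tree root-name) (proj₁ whole)
        refuted = proj₁ (proj₂ whole)
        path : proj₁ whole ⇔ Path R 0 (suc n) (replicate c false) (replicate c false)
        path = proj₂ (proj₂ whole) λ j → at-apply root [] (set j)
        rejected : ¬ Path R 0 (suc n) (replicate c false) (replicate c false) → Accepts C x
        rejected ¬π with bit refuted | evaluates refuted | correct refuted
        ... | true  | e | _ = e
        ... | false | _ | p = contradiction (to path (to p refl)) ¬π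

    family-depth : ∀ g → Depth≤ (family n) ((suc c + 1) * suc ⌊log₂ n ⌋) (Circuit.node (family n) g)
    family-depth g with at g tag Fin.≟ zero
    ... | no tag≢0 = subst (Depth≤ (family n) _) (sym (node-input g tag≢0)) input-depth
      where
      input-depth : Depth≤ (family n) ((suc c + 1) * suc ⌊log₂ n ⌋) (inputNode (at g lo))
      input-depth with toℕ (at g lo) <? n
      ... | yes _ = input _
      ... | no  _ = const _
    ... | yes tag≡0 with toℕ (at g lo) <? toℕ (at g hi)
    ...   | no lo≮hi = subst (Depth≤ (family n) _) (sym (node-empty g tag≡0 lo≮hi)) (const _)
    -- Depth does not depend on the input, so the all-false word can stand for any other.
    ...   | yes lo<hi = depth-mono (family n) bound
              (Refutes.depth (proj₁ (proj₂ (interval (λ _ → false) (suc ⌊log₂ n ⌋) at-g lo<hi hi≤))))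
      where
      at-g : At g (toℕ (at g lo)) (toℕ (at g hi)) (bits g src) (bits g tgt)
      at-g = record { tag≡0 = tag≡0 ; lo≡ = refl ; hi≡ = refl ; src≡ = refl ; tgt≡ = refl }
      hi≤ : toℕ (at g hi) ≤ toℕ (at g lo) + 2 ^ suc ⌊log₂ n ⌋
      hi≤ = ≤-trans (Fin.toℕ≤pred[n] (at g hi)) (≤-trans (n<2^1+⌊log₂n⌋ n) (m≤n+m _ (toℕ (at g lo))))
      -- The additive 1 is absorbed by one more multiple of the positive number `suc ⌊log₂ n ⌋`.
      bound : suc c * suc ⌊log₂ n ⌋ + 1 ≤ (suc c + 1) * suc ⌊log₂ n ⌋
      bound = ≤-trans (+-monoʳ-≤ (suc c * suc ⌊log₂ n ⌋) (subst (1 ≤_) (sym (*-identityˡ (suc ⌊log₂ n ⌋))) (s≤s z≤n)))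
                      (≤-reflexive (sym (*-distribʳ-+ (suc ⌊log₂ n ⌋) (suc c) 1)))

  Rejecting : List Bool → Set
  Rejecting w = ¬ Path (λ a → StepAt (letterAt (List.lookup w) a)) 0 (suc (length w)) (replicate c false) (replicate c false)

  nc¹ : ∀ {L : Language} → (∀ w → L w ⇔ Rejecting w) → NC¹ L
  nc¹ L⇔ = record
    { arity     = arity
    ; circuit   = family
    ; uniform   = treeFamily-uniform tree (subst-of root)
    ; factor    = suc c + 1
    ; log-depth = λ n → family-depth
    ; decides   = λ w → mk⇔ (from (accepts-¬path (List.lookup w)) ∘ to (L⇔ w))
                            (from (L⇔ w) ∘ to (accepts-¬path (List.lookup w)))
    }

-- Finite types

-- Codes may be redundant: a run of the automaton becomes a path as soon as each of its states has
-- some code.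
record Finite (Q : Set) : Set where
  field
    width      : ℕ
    decode     : Vec Bool width → Q
    surjective : ∀ q → ∃[ v ] decode v ≡ q

open Finite

finite-Bool : Finite Bool
finite-Bool .width             = 1
finite-Bool .decode (b ∷ [])   = b
finite-Bool .surjective b      = b ∷ [] , refl

finite-Vec : ∀ n → Finite (Vec Bool n)
finite-Vec n .width        = n
finite-Vec n .decode v     = v
finite-Vec n .surjective v = v , refl

leadingOnes : ∀ {n} → Vec Bool n → Fin (suc n)
leadingOnes []          = zero
leadingOnes (false ∷ v) = zero
leadingOnes (true  ∷ v) = suc (leadingOnes v)

leadingOnes-surjective : ∀ {n} i → ∃[ v ] leadingOnes {n} v ≡ i
leadingOnes-surjective {zero}  zero    = [] , refl
leadingOnes-surjective {suc n} zero    = replicate (suc n) false , refl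
leadingOnes-surjective {suc n} (suc i) = let v , e = leadingOnes-surjective i in true ∷ v , cong suc e

finite-Fin : ∀ n → Finite (Fin (suc n))
finite-Fin n = record { width = n ; decode = leadingOnes ; surjective = leadingOnes-surjective }

take-++ : ∀ {A : Set} {m n} (xs : Vec A m) (ys : Vec A n) → Vec.take m (xs Vec.++ ys) ≡ xs
take-++ {m = m} xs ys = Vec.++-injectiveˡ _ xs (Vec.take++drop≡id m (xs Vec.++ ys))

drop-++ : ∀ {A : Set} {m n} (xs : Vec A m) (ys : Vec A n) → Vec.drop m (xs Vec.++ ys) ≡ ys
drop-++ {m = m} xs ys = Vec.++-injectiveʳ _ xs (Vec.take++drop≡id m (xs Vec.++ ys))

module _ {P Q : Set} (F : Finite P) (G : Finite Q) where

  finite-× : Finite (P × Q)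
  finite-× .width    = width F + width G
  finite-× .decode v = decode F (Vec.take (width F) v) , decode G (Vec.drop (width F) v)
  finite-× .surjective (p , q) =
    let u , d = surjective F p ; v , e = surjective G q in
    u Vec.++ v , cong₂ _,_ (trans (cong (decode F) (take-++ u v)) d) (trans (cong (decode G) (drop-++ u v)) e)

  finite-⊎ : Finite (P ⊎ Q)
  finite-⊎ .width              = suc (width F + width G)
  finite-⊎ .decode (false ∷ v) = inj₁ (decode F (Vec.take (width F) v))
  finite-⊎ .decode (true  ∷ v) = inj₂ (decode G (Vec.drop (width F) v))
  finite-⊎ .surjective (inj₁ p) =
    let u , d = surjective F p ; v = replicate (width G) false in
    false ∷ (u Vec.++ v) , cong inj₁ (trans (cong (decode F) (take-++ u v)) d)
  finite-⊎ .surjective (inj₂ q) =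
    let v , e = surjective G q ; u = replicate (width F) false in
    true ∷ (u Vec.++ v) , cong inj₂ (trans (cong (decode G) (drop-++ u v)) e)

-- Automata

record Automaton (A : Set) : Set₁ where
  field
    State  : Set
    finite : Finite State
    _≟ˢ_   : DecidableEquality State
    Initial  : State → Set
    Move   : A → State → State → Set
    Final    : State → Set
    initial? : ∀ q → Dec (Initial q)
    move?  : ∀ a q r → Dec (Move a q r)
    final?   : ∀ q → Dec (Final q)

  Run : List A → State → Set
  Run []      q = Final q
  Run (a ∷ w) q = ∃[ r ] Move a q r × Run w r

  Accepted : List A → Set
  Accepted w = ∃[ q ] Initial q × Run w q

any-bits? : ∀ {n} {P : Vec Bool n → Set} → (∀ v → Dec (P v)) → Dec (∃ P)
any-bits? {zero}  P? = map′ (λ p → [] , p) (λ { ([] , p) → p }) (P? [])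
any-bits? {suc n} P? = map′
  [ (λ (v , p) → false ∷ v , p) , (λ (v , p) → true ∷ v , p) ]′
  (λ { (false ∷ v , p) → inj₁ (v , p) ; (true ∷ v , p) → inj₂ (v , p) })
  (any-bits? (P? ∘ (false ∷_)) ⊎-dec any-bits? (P? ∘ (true ∷_)))

does-true : ∀ {P : Set} (P? : Dec P) → does P? ≡ true ⇔ P
does-true (yes p) = mk⇔ (λ _ → p) (λ _ → refl)
does-true (no ¬p) = mk⇔ (λ ()) (λ p → contradiction p ¬p)

path-shift : ∀ {Q : Set} {R : ℕ → Q → Q → Set} {a b q s} → Path R (suc a) (suc b) q s ⇔ Path (R ∘ suc) a b q s
path-shift {R = R} = mk⇔ unshift shift
  where
  unshift : ∀ {a b q s} → Path R (suc a) (suc b) q s → Path (R ∘ suc) a b q s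
  unshift []      = []
  unshift (e ∷ π) = e ∷ unshift π
  shift : ∀ {a b q s} → Path (R ∘ suc) a b q s → Path R (suc a) (suc b) q s
  shift []      = []
  shift (e ∷ π) = e ∷ shift π

module _ (M : Automaton Bool) where

  open Automaton M

  private
    c : ℕ
    c = suc (width finite)
    dec : Vec Bool (width finite) → State
    dec = decode finite

    -- The all-false vector is an extra state, in which an initial state of M is guessed.
    first? : ∀ b r → Dec (∃[ v ] Initial (dec v) × Move b (dec v) r)
    first? b r = any-bits? λ v → initial? (dec v) ×-dec move? b (dec v) r

    empty? : Dec (∃[ v ] Initial (dec v) × Final (dec v))
    empty? = any-bits? λ v → initial? (dec v) ×-dec final? (dec v)

    -- Every vector with head `false` acts as the extra state. No step enters one, so an initial
    -- state is guessed only at the start.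
    δ : Bool → Vec Bool c → Vec Bool c → Bool
    δ b _           (false ∷ _) = false
    δ b (false ∷ _) (true ∷ v)  = does (first? b (dec v))
    δ b (true ∷ u)  (true ∷ v)  = does (move? b (dec u) (dec v))

    end : Vec Bool c → Bool
    end (false ∷ _) = does empty?
    end (true ∷ u)  = does (final? (dec u))

    open PathCircuit c δ end using (StepAt; nc¹)

    Steps : List Bool → ℕ → Vec Bool c → Vec Bool c → Set
    Steps w a = StepAt (letterAt (List.lookup w) a)

    path⇒run : ∀ w {v s} → Path (Steps w) 0 (suc (length w)) (true ∷ v) s → Run w (dec v)
    path⇒run []      π = to (does-true (final? _)) (to path-single π)
    path⇒run (b ∷ w) {v} (_∷_ {r = true ∷ v′} e π) =
      dec v′ , to (does-true (move? b (dec v) (dec v′))) e , path⇒run w (to path-shift π)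

    run⇒path : ∀ w {v s} → Run w (dec v) → Path (Steps w) 0 (suc (length w)) (true ∷ v) s
    run⇒path []      end = from path-single (from (does-true (final? _)) end)
    run⇒path (b ∷ w) {v} (r , e , ρ) with surjective finite r
    ... | v′ , refl = from (does-true (move? b (dec v) (dec v′))) e ∷ from path-shift (run⇒path w ρ)

    path⇒accepted : ∀ w {u s} → Path (Steps w) 0 (suc (length w)) (false ∷ u) s → Accepted w
    path⇒accepted []      π =
      let v , st , en = to (does-true empty?) (to path-single π) in dec v , st , en
    path⇒accepted (b ∷ w) (_∷_ {r = true ∷ v′} e π) =
      let v , st , sp = to (does-true (first? b (dec v′))) e in
      dec v , st , dec v′ , sp , path⇒run w (to path-shift π)

    accepted⇒path : ∀ w {u s} → Accepted w → Path (Steps w) 0 (suc (length w)) (false ∷ u) s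
    accepted⇒path w       (q , st , ρ) with surjective finite q
    accepted⇒path []      (q , st , en) | v , refl =
      from path-single (from (does-true empty?) (v , st , en))
    accepted⇒path (b ∷ w) (q , st , r , sp , ρ) | v , refl with surjective finite r
    ... | v′ , refl = from (does-true (first? b (dec v′))) (v , st , sp) ∷ from path-shift (run⇒path w ρ)

  coregular⇒nc¹ : ∀ {L : Language} → (∀ w → L w ⇔ (¬ Accepted w)) → NC¹ L
  coregular⇒nc¹ L⇔ = nc¹ λ w → mk⇔
    (λ l → to (L⇔ w) l ∘ path⇒accepted w)
    (λ ¬π → from (L⇔ w) (¬π ∘ accepted⇒path w))

-- From blocks to bits

module _ (p : ℕ) (M : Automaton (List Bool)) where

  open Automaton M

  Buffer : Set
  Buffer = Vec Bool p × Fin (suc p)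

  contents : Buffer → List Bool
  contents (v , j) = List.take (toℕ j) (Vec.toList v)

  buffer : ∀ l → length l ≤ p → ∃[ β ] contents β ≡ l
  buffer l l≤p =
    let v , e = pad p l l≤p in
    (v , fromℕ< (s≤s l≤p)) , trans (cong (λ j → List.take j (Vec.toList v)) (Fin.toℕ-fromℕ< (s≤s l≤p))) e
    where
    pad : ∀ p l → length l ≤ p → ∃[ v ] List.take (length l) (Vec.toList {n = p} v) ≡ l
    pad p       []      _         = replicate p false , refl
    pad (suc p) (b ∷ l) (s≤s l≤p) = let v , e = pad p l l≤p in b ∷ v , cong (b ∷_) e

  -- A buffer holds the guessed rest of the current block.
  BitStep : Bool → List Bool → State → List Bool → State → Set
  BitStep b []      q l r = length l ≡ p × Move (b ∷ l) q r
  BitStep b (x ∷ k) q l r = b ≡ x × k ≡ l × q ≡ r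

  bitStep? : ∀ b k q l r → Dec (BitStep b k q l r)
  bitStep? b []      q l r = (length l ≟ p) ×-dec move? (b ∷ l) q r
  bitStep? b (x ∷ k) q l r = (b Bool.≟ x) ×-dec (List.≡-dec Bool._≟_ k l) ×-dec (q ≟ˢ r)

  -- A word whose length is not a multiple of suc p starts inside a block; such words are all accepted.
  bitAutomaton : Automaton Bool
  bitAutomaton = record
    { State  = Buffer × State
    ; finite = finite-× (finite-× (finite-Vec p) (finite-Fin p)) finite
    ; _≟ˢ_   = Product.≡-dec (Product.≡-dec (Vec.≡-dec Bool._≟_) Fin._≟_) _≟ˢ_
    ; Initial  = λ (β , q) → contents β ≢ [] ⊎ Initial q
    ; Move   = λ b (β , q) (γ , r) → BitStep b (contents β) q (contents γ) r
    ; Final    = λ (β , q) → contents β ≡ [] × Final q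
    ; initial? = λ (β , q) → ¬? (List.≡-dec Bool._≟_ (contents β) []) ⊎-dec initial? q
    ; move?  = λ b (β , q) (γ , r) → bitStep? b (contents β) q (contents γ) r
    ; final?   = λ (β , q) → List.≡-dec Bool._≟_ (contents β) [] ×-dec final? q
    }

  module Bit = Automaton bitAutomaton

  Blocks : List (List Bool) → Set
  Blocks = All λ B → length B ≡ suc p

  -- A guessed block is checked letter by letter, and a new guess is made only when the buffer is
  -- empty; so the word is the rest of one block followed by whole blocks.
  bit⇒block : ∀ w {β q} → Bit.Run w (β , q) → ∃[ Bs ] Blocks Bs × w ≡ contents β ++ concat Bs × Run Bs q
  bit⇒block []      {β} (e , end) = [] , [] , cong (_++ []) (sym e) , end
  bit⇒block (b ∷ w) {β} ((γ , r) , st , ρ) with contents β | bit⇒block w ρ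
  bit⇒block (b ∷ w) {β} ((γ , r) , (len , st) , ρ) | [] | Bs , ok , refl , ρ′ =
    (b ∷ contents γ) ∷ Bs , cong suc len ∷ ok , refl , r , st , ρ′
  bit⇒block (b ∷ w) {β} ((γ , r) , (refl , refl , refl) , ρ) | _ ∷ _ | Bs , ok , refl , ρ′ = Bs , ok , refl , ρ′

  length-contents : ∀ β → length (contents β) ≤ p
  length-contents (v , j) = ≤-trans (≤-reflexive (List.length-take (toℕ j) _)) (≤-trans (m⊓n≤n (toℕ j) _) (≤-reflexive (Vec.length-toList v)))

  block⇒bit : ∀ l Bs {q} → Blocks Bs → Run Bs q → ∀ β → contents β ≡ l → Bit.Run (l ++ concat Bs) (β , q)
  block⇒bit []      []       ok end β e = e , end
  block⇒bit []      ((b ∷ B) ∷ Bs) {q} (len ∷ ok) (r , st , ρ) β e =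
    let γ , f = buffer B (≤-reflexive (suc-injective len)) in
    (γ , r) , subst₂ (λ k l → BitStep b k q l r) (sym e) (sym f) (suc-injective len , st) , block⇒bit B Bs ok ρ γ f
  block⇒bit (x ∷ l) Bs {q} ok ρ β e =
    let γ , f = buffer l (≤-trans (n≤1+n _) (subst (λ k → length k ≤ p) e (length-contents β))) in
    (γ , q) , subst₂ (λ k l → BitStep x k q l q) (sym e) (sym f) (refl , refl , refl) , block⇒bit l Bs ok ρ γ f

open Automaton using (Accepted; Run)

𝟙 : Bool → ℕ
𝟙 b = if b then 1 else 0

-- Recognizing layouts of columns

module Columns (p : ℕ) where

  Column : Set
  Column = Fin (suc p) × Bool

  block : Column → List Bool
  block (v , m) = unary p (toℕ v) ++ [ m ]

  length-block : ∀ c → length (block c) ≡ suc p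
  length-block (v , m) = begin
    length (unary p (toℕ v) ++ [ m ])   ≡⟨ List.length-++ (unary p (toℕ v)) ⟩
    length (unary p (toℕ v)) + 1        ≡⟨ cong (_+ 1) (List.length-applyUpTo (_<ᵇ toℕ v) p) ⟩
    p + 1                               ≡⟨ +-comm p 1 ⟩
    suc p                               ∎
    where open ≡-Reasoning

  unary-injective : ∀ {n v w} → v ≤ n → w ≤ n → unary n v ≡ unary n w → v ≡ w
  unary-injective {zero}  z≤n     z≤n     _ = refl
  unary-injective {suc n} z≤n     z≤n     _ = refl
  unary-injective {suc n} (s≤s v≤n) (s≤s w≤n) e = cong suc (unary-injective v≤n w≤n (List.∷-injectiveʳ e))

  block-injective : ∀ c d → block c ≡ block d → c ≡ d
  block-injective (v , m) (w , n) e =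
    cong₂ _,_ (Fin.toℕ-injective (unary-injective (Fin.toℕ≤pred[n] v) (Fin.toℕ≤pred[n] w) (List.∷ʳ-injectiveˡ _ _ e)))
              (List.∷ʳ-injectiveʳ (unary p (toℕ v)) _ e)

  column? : ∀ B → Dec (∃[ c ] B ≡ block c)
  column? B = map′
    (λ { (v , inj₁ e) → (v , false) , e ; (v , inj₂ e) → (v , true) , e })
    (λ { ((v , false) , e) → v , inj₁ e ; ((v , true) , e) → v , inj₂ e })
    (Fin.any? λ v → List.≡-dec Bool._≟_ B (block (v , false)) ⊎-dec List.≡-dec Bool._≟_ B (block (v , true)))

  flat : (ℕ → Bool) → ℕ → List Column
  flat f = applyUpTo (λ i → zero , f i)

  -- Since `k` exceeds the length of `s`, the mark falls among the `p` zero columns after `s`. Its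
  -- offset there is `z`, so that `k` is `length s + z + 1`.
  layout : gSM p → ℕ → List Column
  layout s z = List.map (_, false) s ++ flat (_≡ᵇ z) p

  encode-layout : ∀ s z → encode s (suc (length s + z)) ≡ concat (List.map block (layout s z))
  encode-layout s z = cong concat (go s)
    where
    go : ∀ s → applyUpTo (λ i → unary p (nth s i) ++ [ suc i ≡ᵇ suc (length s + z) ]) (length s + p) ≡
               List.map block (layout s z)
    go []      = sym (List.map-applyUpTo (λ i → zero , (i ≡ᵇ z)) block p)
    go (v ∷ s) = cong (block (v , false) ∷_) (go s)

  Parse : Set
  Parse = (Fin (suc p) × Bool) ⊎ Bool

  -- tail r m: r columns of slope 0 are still to come before those of s, and m
  -- tells whether a mark has been seen.
  pattern tail r m = inj₁ (r , m)
  pattern body     = inj₂ true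
  pattern dead     = inj₂ false

  parse₁ : Parse → Column → Parse
  parse₁ (tail (suc r) m)     (zero , false) = tail (inject₁ r) m
  parse₁ (tail (suc r) false) (zero , true)  = tail (inject₁ r) true
  parse₁ (tail zero true)     (_ , false)    = body
  parse₁ body                 (_ , false)    = body
  parse₁ _                    _              = dead

  parseBlock : List Bool → Parse → Parse
  parseBlock B e with column? B
  ... | yes (c , _) = parse₁ e c
  ... | no _        = dead

  -- The slopes of `s` may end in zeros, so from the left the end of `s` cannot be recognized in
  -- time. From the right the padding is simply the first `p` columns read.
  parse : List (List Bool) → Parse
  parse = List.foldr parseBlock (tail (fromℕ p) false)

  parseBlock-block : ∀ c e → parseBlock (block c) e ≡ parse₁ e c
  parseBlock-block c e with column? (block c)
  ... | yes (d , eq) = cong (parse₁ e) (sym (block-injective c d eq))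
  ... | no ¬c        = contradiction (c , refl) ¬c

  -- The empty configuration triggers nothing and is excluded; `parse₁` achieves this by reaching
  -- `body` only through one further unmarked column.
  IsLayout : List (List Bool) → Set
  IsLayout Bs = ∃[ v ] ∃[ s ] ∃[ z ] z < p × Bs ≡ List.map block (layout (v ∷ s) z)

  -- Soundness of parsing; `t` is the number of padding columns read so far. Nothing is claimed for
  -- `dead`: that no layout ends there is the content of `parse-layout`.
  Parsed : Parse → List (List Bool) → Set
  Parsed (tail r false) Bs = ∃[ t ] t + toℕ r ≡ p × Bs ≡ List.map block (flat (λ _ → false) t)
  Parsed (tail r true)  Bs = ∃[ t ] t + toℕ r ≡ p × ∃[ z ] z < t × Bs ≡ List.map block (flat (_≡ᵇ z) t)
  Parsed body           Bs = IsLayout Bs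
  Parsed dead           Bs = ⊤

  shift-count : ∀ t (r : Fin p) → t + suc (toℕ r) ≡ p → suc t + toℕ (inject₁ r) ≡ p
  shift-count t r eq = trans (cong (suc t +_) (Fin.toℕ-inject₁ r)) (trans (sym (+-suc t (toℕ r))) eq)

  parsed₁ : ∀ c e Bs → Parsed e Bs → Parsed (parse₁ e c) (block c ∷ Bs)
  parsed₁ (zero , false)  (tail (suc r) false) _ (t , eq , refl) = suc t , shift-count t r eq , refl
  parsed₁ (zero , false)  (tail (suc r) true)  _ (t , eq , z , z<t , refl) =
    suc t , shift-count t r eq , suc z , s≤s z<t , refl
  parsed₁ (zero , true)   (tail (suc r) false) _ (t , eq , refl) = suc t , shift-count t r eq , 0 , s≤s z≤n , refl
  parsed₁ (zero , true)   (tail (suc r) true)  _ _ = tt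
  parsed₁ (suc v , false) (tail (suc r) m)     _ _ = tt
  parsed₁ (suc v , true)  (tail (suc r) false) _ _ = tt
  parsed₁ (suc v , true)  (tail (suc r) true)  _ _ = tt
  parsed₁ (v , false)     (tail zero true)     _ (t , eq , z , z<t , refl)
    with refl ← trans (sym (+-identityʳ t)) eq = v , [] , z , z<t , refl
  parsed₁ (v , false)     (tail zero false)    _ _ = tt
  parsed₁ (v , true)      (tail zero false)    _ _ = tt
  parsed₁ (v , true)      (tail zero true)     _ _ = tt
  parsed₁ (v , false)     body _ (w , s , z , z<p , refl) = v , w ∷ s , z , z<p , refl
  parsed₁ (v , true)      body _ _ = tt
  parsed₁ (v , m)         dead _ _ = tt

  parsed : ∀ Bs → Parsed (parse Bs) Bs
  parsed []       = 0 , Fin.toℕ-fromℕ p , refl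
  parsed (B ∷ Bs) with column? B
  ... | yes (c , refl) = parsed₁ c (parse Bs) Bs (parsed Bs)
  ... | no _           = tt

  parseColumns : List Column → Parse
  parseColumns = List.foldr (λ c e → parse₁ e c) (tail (fromℕ p) false)

  parse-blocks : ∀ cs → parse (List.map block cs) ≡ parseColumns cs
  parse-blocks []       = refl
  parse-blocks (c ∷ cs) = trans (parseBlock-block c _) (cong (λ e → parse₁ e c) (parse-blocks cs))

  predecessor : ∀ (r : Fin (suc p)) {t} → toℕ r + suc t ≡ p → ∃[ i ] inject₁ i ≡ r × toℕ (Fin.suc i) + t ≡ p
  predecessor r {t} eq = fromℕ< r<p , Fin.toℕ-injective (trans (Fin.toℕ-inject₁ _) (Fin.toℕ-fromℕ< r<p)) ,
    trans (cong (λ k → suc (k + t)) (Fin.toℕ-fromℕ< r<p)) (trans (sym (+-suc (toℕ r) t)) eq)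
    where
    r<p : toℕ r < p
    r<p = ≤-trans (m≤m+n (suc (toℕ r)) t) (≤-reflexive (trans (sym (+-suc (toℕ r) t)) eq))

  parse-unmarked : ∀ t r → toℕ r + t ≡ p → parseColumns (flat (λ _ → false) t) ≡ tail r false
  parse-unmarked zero    r eq = cong (λ r → tail r false)
    (Fin.toℕ-injective (trans (Fin.toℕ-fromℕ p) (sym (trans (sym (+-identityʳ (toℕ r))) eq))))
  parse-unmarked (suc t) r eq with predecessor r eq
  ... | i , refl , eq′ rewrite parse-unmarked t (suc i) eq′ = refl

  parse-marked : ∀ t r z → z < t → toℕ r + t ≡ p → parseColumns (flat (_≡ᵇ z) t) ≡ tail r true
  parse-marked (suc t) r z z<t eq with predecessor r eq
  parse-marked (suc t) r zero    _         eq | i , refl , eq′ rewrite parse-unmarked t (suc i) eq′ = refl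
  parse-marked (suc t) r (suc z) (s≤s z<t) eq | i , refl , eq′ rewrite parse-marked t (suc i) z z<t eq′ = refl

  parse-layout : ∀ v s z → z < p → parse (List.map block (layout (v ∷ s) z)) ≡ body
  parse-layout v s z z<p = trans (parse-blocks (layout (v ∷ s) z)) (go v s)
    where
    go : ∀ v s → parseColumns (layout (v ∷ s) z) ≡ body
    go v []      rewrite parse-marked p zero z z<p refl = refl
    go v (w ∷ s) rewrite go w s                          = refl

  -- Label y belongs to column y + 1 - p.

  Labelling : Set
  Labelling = ℕ → Bool

  -- Closure at column `y + 1`: its own label is `y + p`, its right neighbour has label
  -- `suc (y + p)`, and the column `p` to its left has label `y`.
  stable-at : gSM p → Labelling → ℕ → Set
  stable-at s g y = g (y + p) ≡ false → nth s y + (p * 𝟙 (g (suc (y + p))) + 𝟙 (g y)) ≤ p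

  -- At column `i` the labels are those of `i - p`, `i` and `i + 1`. At the mark, `x` is thus the
  -- label of `k - p`, the column whose firing would send a grain to `k`.
  Local : Column → Bool → Bool → Bool → Set
  Local (v , m) x y z = (y ≡ false → toℕ v + (p * 𝟙 z + 𝟙 x) ≤ p) × (m ≡ true → x ≡ false)

  local? : ∀ c x y z → Dec (Local c x y z)
  local? (v , m) x y z =
    ((y Bool.≟ false) →-dec (toℕ v + (p * 𝟙 z + 𝟙 x) ≤? p)) ×-dec ((m Bool.≟ true) →-dec (x Bool.≟ false))

  Closed : List Column → Labelling → Set
  Closed []       g = ⊤
  Closed (c ∷ cs) g = Local c (g 0) (g p) (g (suc p)) × Closed cs (g ∘ suc)

  closed-flat⇒ : ∀ {f t g} → Closed (flat f t) g → ∀ {i} → i < t → f i ≡ true → g i ≡ false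
  closed-flat⇒ {t = suc t} ((_ , m) , _) {zero}  _         e = m e
  closed-flat⇒ {t = suc t} (_ , cl)      {suc i} (s≤s i<t) e = closed-flat⇒ cl i<t e

  closed-flat⇐ : ∀ {f} t {g} → (∀ y → stable-at [] g y) → (∀ i → f i ≡ true → g i ≡ false) → Closed (flat f t) g
  closed-flat⇐ zero    st m = tt
  closed-flat⇐ (suc t) st m = (st 0 , m 0) , closed-flat⇐ t (st ∘ suc) (m ∘ suc)

  closed-layout⇒ : ∀ s {z} g → z < p → Closed (layout s z) g →
                   (∀ y → y < length s → stable-at s g y) × g (length s + z) ≡ false
  closed-layout⇒ []      {z} g z<p cl = (λ _ ()) , closed-flat⇒ cl z<p (to Bool.T-≡ (≡⇒≡ᵇ z z refl))
  closed-layout⇒ (v ∷ s) g z<p ((st , _) , cl) =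
    let sts , m = closed-layout⇒ s (g ∘ suc) z<p cl in
    (λ { zero _ → st ; (suc y) (s≤s y<s) → sts y y<s }) , m

  closed-layout⇐ : ∀ s {z} g → (∀ y → stable-at s g y) → g (length s + z) ≡ false → Closed (layout s z) g
  closed-layout⇐ []      {z} g st m =
    closed-flat⇐ p st λ i e → subst (λ i → g i ≡ false) (sym (≡ᵇ⇒≡ i z (from Bool.T-≡ e))) m
  closed-layout⇐ (v ∷ s) g st m = (st 0 , λ ()) , closed-layout⇐ s (g ∘ suc) (st ∘ suc) m

  -- The automaton has two parts: the first parses from the right and accepts
  -- what is not a layout of a nonempty configuration, the second accepts
  -- what has a closed labelling in which label 0 is true.

  Window : Set
  Window = Vec Bool (suc p)

  Shift : Window → Window → Set
  Shift W X = ∀ i → lookup W (suc i) ≡ lookup X (inject₁ i)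

  State : Set
  State = Parse ⊎ Window

  Initial : State → Set
  Initial (inj₁ e)       = e ≢ body
  Initial (inj₂ (b ∷ _)) = b ≡ true

  -- The automaton reads from the left what the parser reads from the right: `e` is a guessed parse
  -- result and `f` the one for the remaining blocks. Each list of blocks admits exactly one such
  -- run, and this is what makes the negative condition `e ≢ body` in `Initial` sound.
  Move : List Bool → State → State → Set
  Move B (inj₁ e) (inj₁ f) = e ≡ parseBlock B f
  Move B (inj₂ W) (inj₂ X) =
    Shift W X × ∃[ c ] B ≡ block c × Local c (lookup W zero) (lookup W (fromℕ p)) (lookup X (fromℕ p))
  Move B _        _        = ⊥

  Final : State → Set
  Final (inj₁ e) = e ≡ tail (fromℕ p) false
  Final (inj₂ W) = ⊤

  infix 4 _≟ᵖ_

  _≟ᵖ_ : DecidableEquality Parse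
  _≟ᵖ_ = Sum.≡-dec (Product.≡-dec Fin._≟_ Bool._≟_) Bool._≟_

  initial? : ∀ q → Dec (Initial q)
  initial? (inj₁ e)       = ¬? (e ≟ᵖ body)
  initial? (inj₂ (b ∷ _)) = b Bool.≟ true

  move? : ∀ B q r → Dec (Move B q r)
  move? B (inj₁ e) (inj₁ f) = e ≟ᵖ parseBlock B f
  move? B (inj₁ _) (inj₂ _) = no λ ()
  move? B (inj₂ _) (inj₁ _) = no λ ()
  move? B (inj₂ W) (inj₂ X) = Fin.all? (λ i → lookup W (suc i) Bool.≟ lookup X (inject₁ i)) ×-dec local-block?
    where
    local-block? : Dec (∃[ c ] B ≡ block c × Local c (lookup W zero) (lookup W (fromℕ p)) (lookup X (fromℕ p)))
    local-block? with column? B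
    ... | no ¬c         = no λ (c , e , _) → ¬c (c , e)
    ... | yes (c , e) = map′ (λ l → c , e , l)
      (λ (d , f , l) → subst (λ c → Local c _ _ _) (block-injective d c (trans (sym f) e)) l) (local? c _ _ _)

  final? : ∀ q → Dec (Final q)
  final? (inj₁ e) = e ≟ᵖ tail (fromℕ p) false
  final? (inj₂ W) = yes tt

  automaton : Automaton (List Bool)
  automaton = record
    { State    = State
    ; finite   = finite-⊎ (finite-⊎ (finite-× (finite-Fin p) finite-Bool) finite-Bool) (finite-Vec (suc p))
    ; _≟ˢ_     = Sum.≡-dec _≟ᵖ_ (Vec.≡-dec Bool._≟_)
    ; Initial  = Initial
    ; Move     = Move
    ; Final    = Final
    ; initial? = initial?
    ; move?    = move?
    ; final?   = final?
    }

  run-parse⇒ : ∀ Bs {e} → Run automaton Bs (inj₁ e) → e ≡ parse Bs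
  run-parse⇒ []       e                = e
  run-parse⇒ (B ∷ Bs) (inj₁ f , e , ρ) = trans e (cong (parseBlock B) (run-parse⇒ Bs ρ))

  run-parse⇐ : ∀ Bs → Run automaton Bs (inj₁ (parse Bs))
  run-parse⇐ []       = refl
  run-parse⇐ (B ∷ Bs) = inj₁ (parse Bs) , refl , run-parse⇐ Bs

  IsWindow : Window → Labelling → Set
  IsWindow W g = ∀ i → lookup W i ≡ g (toℕ i)

  window : Labelling → Window
  window g = tabulate (g ∘ toℕ)

  isWindow-window : ∀ g → IsWindow (window g) g
  isWindow-window g = Vec.lookup∘tabulate (g ∘ toℕ)

  last-label : ∀ W g → IsWindow W g → lookup W (fromℕ p) ≡ g p
  last-label W g w = trans (w (fromℕ p)) (cong g (Fin.toℕ-fromℕ p))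

  run-window⇒ : ∀ cs {W} → Run automaton (List.map block cs) (inj₂ W) → ∃[ g ] IsWindow W g × Closed cs g
  run-window⇒ [] {W} _ = g , correct , tt
    where
    g : Labelling
    g y with y <? suc p
    ... | yes y<p = lookup W (fromℕ< y<p)
    -- No column constrains the labels past the last window, so any default works.
    ... | no _    = false
    correct : IsWindow W g
    correct i with toℕ i <? suc p
    ... | yes i<p = cong (lookup W) (sym (Fin.fromℕ<-toℕ i i<p))
    ... | no i≮p  = contradiction (Fin.toℕ<n i) i≮p
  run-window⇒ (c ∷ cs) {W} (inj₂ X , (sh , d , e , l) , ρ) with refl ← block-injective c d e with run-window⇒ cs ρ
  ... | g , w , cl = h , correct , subst₂ (Local c (lookup W zero)) (last-label W h correct) (last-label X g w) l , cl
    where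
    h : Labelling
    h zero    = lookup W zero
    h (suc y) = g y
    correct : IsWindow W h
    correct zero    = refl
    correct (suc i) = trans (sh i) (trans (w (inject₁ i)) (cong g (Fin.toℕ-inject₁ i)))

  run-window⇐ : ∀ cs g → Closed cs g → Run automaton (List.map block cs) (inj₂ (window g))
  run-window⇐ []       g _      = tt
  run-window⇐ (c ∷ cs) g (l , cl) =
    inj₂ (window (g ∘ suc)) ,
    ((λ i → trans (isWindow-window g (suc i)) (sym (trans (isWindow-window (g ∘ suc) (inject₁ i)) (cong (g ∘ suc) (Fin.toℕ-inject₁ i))))) ,
     c , refl , subst₂ (Local c (g 0)) (sym (last-label (window g) g (isWindow-window g))) (sym (last-label (window (g ∘ suc)) (g ∘ suc) (isWindow-window (g ∘ suc)))) l) ,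
    run-window⇐ cs (g ∘ suc) cl

-- The avalanche

open import Data.Integer.Base as ℤ using (ℤ; +_; -[1+_])
import Data.Integer.Properties as ℤ
open import Data.Integer.Tactic.RingSolver using (solve-∀)

if-add : ∀ b (u d : ℤ) → (if b then u ℤ.+ d else u) ≡ u ℤ.+ (if b then d else + 0)
if-add true  u d = refl
if-add false u d = sym (ℤ.+-identityʳ u)

addAt-+ : ∀ m d s n → addAt (+ m) d s (+ n) ≡ s (+ n) ℤ.+ (if m ≡ᵇ n then d else + 0)
addAt-+ m d s n = trans (cong (λ b → if b then s (+ n) ℤ.+ d else s (+ n)) (isYes≗does (+ m ℤ.≟ + n))) (if-add (m ≡ᵇ n) (s (+ n)) d)

if-pos : ∀ b n → (if b then + n else + 0) ≡ + (n * 𝟙 b)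
if-pos true  n = cong +_ (sym (*-identityʳ n))
if-pos false n = cong +_ (sym (*-zeroʳ n))

if-neg : ∀ b n → (if b then ℤ.- + n else + 0) ≡ ℤ.- + (n * 𝟙 b)
if-neg true  n = cong (λ k → ℤ.- + k) (sym (*-identityʳ n))
if-neg false n = cong (λ k → ℤ.- + k) (sym (*-zeroʳ n))

≡ᵇ-cancel-+ : ∀ m n p → (m + p ≡ᵇ n + p) ≡ (m ≡ᵇ n)
≡ᵇ-cancel-+ m n zero    = cong₂ _≡ᵇ_ (+-identityʳ m) (+-identityʳ n)
≡ᵇ-cancel-+ m n (suc p) = trans (cong₂ _≡ᵇ_ (+-suc m p) (+-suc n p)) (≡ᵇ-cancel-+ m n p)

𝟙≤1 : ∀ b → 𝟙 b ≤ 1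
𝟙≤1 true  = ≤-refl
𝟙≤1 false = z≤n

𝟙-mono : ∀ {a b} → (a ≡ true → b ≡ true) → 𝟙 a ≤ 𝟙 b
𝟙-mono {false} _ = z≤n
𝟙-mono {true}  h = ≤-reflexive (cong 𝟙 (sym (h refl)))

n*𝟙≤n : ∀ n b → n * 𝟙 b ≤ n
n*𝟙≤n n b = ≤-trans (*-monoʳ-≤ n (𝟙≤1 b)) (≤-reflexive (*-identityʳ n))

mark : ℕ → (ℕ → Bool) → ℕ → Bool
mark x f z = (x ≡ᵇ z) ∨ f z

mark-self : ∀ x f → mark x f x ≡ true
mark-self x f = cong (_∨ f x) (to Bool.T-≡ (≡⇒≡ᵇ x x refl))

mark-true : ∀ x f z → mark x f z ≡ true → x ≡ z ⊎ f z ≡ true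
mark-true x f z e with x ≡ᵇ z in eq
... | true  = inj₁ (≡ᵇ⇒≡ x z (from Bool.T-≡ eq))
... | false = inj₂ e

mark-keeps : ∀ x f z → f z ≡ true → mark x f z ≡ true
mark-keeps x f z e = trans (cong ((x ≡ᵇ z) ∨_) e) (Bool.∨-zeroʳ (x ≡ᵇ z))

-- A new label is added to a set not containing it, so the indicators add up.
𝟙-mark : ∀ x f z → f x ≡ false → 𝟙 (mark x f z) ≡ 𝟙 (f z) + 𝟙 (x ≡ᵇ z)
𝟙-mark x f z e with x ≡ᵇ z in eq
... | false = sym (+-identityʳ _)
... | true  with refl ← ≡ᵇ⇒≡ x z (from Bool.T-≡ eq) = cong (λ b → 𝟙 b + 1) (sym e)

module Avalanche (p : ℕ) (1≤p : 1 ≤ p) (s : gSM p) where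

  open Columns p using (Labelling; stable-at)

  nth≤p : ∀ (s : gSM p) y → nth s y ≤ p
  nth≤p []      y       = z≤n
  nth≤p (v ∷ s) zero    = Fin.toℕ≤pred[n] v
  nth≤p (v ∷ s) (suc y) = nth≤p s y

  nth-beyond : ∀ (s : gSM p) {y} → length s ≤ y → nth s y ≡ 0
  nth-beyond []      _                 = refl
  nth-beyond (v ∷ s) {suc y} (s≤s le) = nth-beyond s le

  inflow : Labelling → ℕ → ℕ
  inflow f y = nth s y + (p * 𝟙 (f (suc (y + p))) + 𝟙 (f y))

  -- The slopes after the columns labelled by f have fired once each.  Adding
  -- a grain to column 1 has the effect of firing column 1 - p, whose label is f 0.
  fired : Labelling → Slopes
  fired f (+ zero)  = + (p * 𝟙 (f p))
  fired f (+ suc y) = + inflow f y ℤ.- + (suc p * 𝟙 (f (y + p)))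
  fired f -[1+ _ ]  = + 0

  -- A firing changes three slopes, and a new label changes the three matching indicator terms of
  -- `fired`; `≡ᵇ-cancel-+` translates between columns and labels, which differ by the shift `p`.
  fire-fired : ∀ {t f y} → (∀ j → t j ≡ fired f j) → f (y + p) ≡ false →
               ∀ j → fire p (+ suc y) t j ≡ fired (mark (y + p) f) j
  fire-fired {t} {f} {y} t≡ unfired -[1+ n ]  = t≡ -[1+ n ]
  fire-fired {t} {f} {y} t≡ unfired (+ zero)  = begin
    addAt (+ y) (+ p) t (+ 0)                                 ≡⟨ addAt-+ y (+ p) t 0 ⟩
    t (+ 0) ℤ.+ (if y ≡ᵇ 0 then + p else + 0)                 ≡⟨ cong₂ ℤ._+_ (t≡ (+ 0)) (if-pos (y ≡ᵇ 0) p) ⟩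
    + (p * 𝟙 (f p) + p * 𝟙 (y ≡ᵇ 0))                          ≡⟨ cong +_ (sym (*-distribˡ-+ p (𝟙 (f p)) (𝟙 (y ≡ᵇ 0)))) ⟩
    + (p * (𝟙 (f p) + 𝟙 (y ≡ᵇ 0)))                            ≡⟨ cong (λ b → + (p * (𝟙 (f p) + 𝟙 b))) (sym (≡ᵇ-cancel-+ y 0 p)) ⟩
    + (p * (𝟙 (f p) + 𝟙 (y + p ≡ᵇ p)))                        ≡⟨ cong (λ k → + (p * k)) (sym (𝟙-mark (y + p) f p unfired)) ⟩
    + (p * 𝟙 (mark (y + p) f p))                              ∎
    where open ≡-Reasoning
  fire-fired {t} {f} {y} t≡ unfired (+ suc z) = begin
    addAt (+ y) (+ p) t₂ (+ suc z)
      ≡⟨ addAt-+ y (+ p) t₂ (suc z) ⟩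
    t₂ (+ suc z) ℤ.+ (if a then + p else + 0)
      ≡⟨ cong₂ ℤ._+_ (addAt-+ (suc y) e t₁ (suc z)) (if-pos a p) ⟩
    t₁ (+ suc z) ℤ.+ (if b then e else + 0) ℤ.+ + (p * 𝟙 a)
      ≡⟨ cong₂ (λ k l → k ℤ.+ l ℤ.+ + (p * 𝟙 a)) (addAt-+ (suc (y + p)) (+ 1) t (suc z)) (if-neg b (suc p)) ⟩
    t (+ suc z) ℤ.+ (if c then + 1 else + 0) ℤ.+ (ℤ.- + (suc p * 𝟙 b)) ℤ.+ + (p * 𝟙 a)
      ≡⟨ cong₂ (λ k l → k ℤ.+ l ℤ.+ (ℤ.- + (suc p * 𝟙 b)) ℤ.+ + (p * 𝟙 a)) (t≡ (+ suc z)) (trans (if-pos c 1) (cong +_ (*-identityˡ (𝟙 c)))) ⟩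
    + (n + (p * C + A)) ℤ.- + (suc p * F) ℤ.+ + 𝟙 c ℤ.+ (ℤ.- + (suc p * 𝟙 b)) ℤ.+ + (p * 𝟙 a)
      ≡⟨ rearrange (+ n) (+ (p * C)) (+ A) (+ (suc p * F)) (+ 𝟙 c) (+ (suc p * 𝟙 b)) (+ (p * 𝟙 a)) ⟩
    + (n + ((p * C + p * 𝟙 a) + (A + 𝟙 c))) ℤ.- + (suc p * F + suc p * 𝟙 b)
      ≡⟨ cong₂ (λ k l → + (n + (k + (A + 𝟙 c))) ℤ.- + l) (sym (*-distribˡ-+ p C (𝟙 a))) (sym (*-distribˡ-+ (suc p) F (𝟙 b))) ⟩
    + (n + (p * (C + 𝟙 a) + (A + 𝟙 c))) ℤ.- + (suc p * (F + 𝟙 b))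
      ≡⟨ cong₂ (λ k l → + (n + (p * (C + 𝟙 k) + (A + 𝟙 c))) ℤ.- + (suc p * (F + 𝟙 l))) (sym (≡ᵇ-cancel-+ y (suc z) p)) (sym (≡ᵇ-cancel-+ y z p)) ⟩
    + (n + (p * (C + 𝟙 (y + p ≡ᵇ suc (z + p))) + (A + 𝟙 c))) ℤ.- + (suc p * (F + 𝟙 (y + p ≡ᵇ z + p)))
      ≡⟨ cong₂ (λ k l → + (n + (p * k + l)) ℤ.- + (suc p * (F + 𝟙 (y + p ≡ᵇ z + p)))) (sym (𝟙-mark (y + p) f (suc (z + p)) unfired)) (sym (𝟙-mark (y + p) f z unfired)) ⟩
    + inflow (mark (y + p) f) z ℤ.- + (suc p * (F + 𝟙 (y + p ≡ᵇ z + p)))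
      ≡⟨ cong (λ k → + inflow (mark (y + p) f) z ℤ.- + (suc p * k)) (sym (𝟙-mark (y + p) f (z + p) unfired)) ⟩
    fired (mark (y + p) f) (+ suc z) ∎
    where
    open ≡-Reasoning
    t₁ t₂ : Slopes
    t₁ = addAt (+ suc (y + p)) (+ 1) t
    t₂ = addAt (+ suc y) (ℤ.- + suc p) t₁
    e : ℤ
    e = ℤ.- + suc p
    a b c : Bool
    a = y ≡ᵇ suc z
    b = y ≡ᵇ z
    c = y + p ≡ᵇ z
    n C A F : ℕ
    n = nth s z
    C = 𝟙 (f (suc (z + p)))
    A = 𝟙 (f z)
    F = 𝟙 (f (z + p))
    rearrange : ∀ n X A Y a Y′ X′ →
      n ℤ.+ (X ℤ.+ A) ℤ.- Y ℤ.+ a ℤ.+ (ℤ.- Y′) ℤ.+ X′ ≡ n ℤ.+ ((X ℤ.+ X′) ℤ.+ (A ℤ.+ a)) ℤ.- (Y ℤ.+ Y′)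
    rearrange = solve-∀

  -- `support` confines the fired columns to `s`. This determines the slopes beyond `s`.
  record Reached (t : Slopes) (f : Labelling) : Set where
    field
      slopes≡ : ∀ j → t j ≡ fired f j
      grain   : f 0 ≡ true
      support : ∀ {x} → f x ≡ true → x ≡ 0 ⊎ ∃[ y ] y < length s × x ≡ y + p

  open Reached

  y+p≢0 : ∀ y → y + p ≢ 0
  y+p≢0 y e = <⇒≢ (≤-trans 1≤p (m≤n+m p y)) (sym e)

  grain-only : ∀ y → (0 ≡ᵇ y + p) ≡ false
  grain-only y with y + p in e
  ... | zero  = contradiction e (y+p≢0 y)
  ... | suc _ = refl

  reached-start : Reached (addGrain (slopes s)) (0 ≡ᵇ_)
  reached-start .grain           = refl
  reached-start .support {zero} _ = inj₁ refl
  reached-start .slopes≡ -[1+ n ] = refl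
  reached-start .slopes≡ (+ zero) = cong +_ (sym (trans (cong (λ b → p * 𝟙 b) (grain-only 0)) (*-zeroʳ p)))
  reached-start .slopes≡ (+ suc y) = begin
    addGrain (slopes s) (+ suc y)                                          ≡⟨ addAt-+ 1 (+ 1) (slopes s) (suc y) ⟩
    + nth s y ℤ.+ (if b then + 1 else + 0)                                 ≡⟨ cong (λ k → + nth s y ℤ.+ k) (if-pos b 1) ⟩
    + (nth s y + 1 * 𝟙 b)                                                  ≡⟨ cong (λ k → + (nth s y + k)) (*-identityˡ (𝟙 b)) ⟩
    + (nth s y + 𝟙 b)                                                      ≡⟨ cong (λ k → + (nth s y + (k + 𝟙 b))) (sym (*-zeroʳ p)) ⟩
    + inflow (0 ≡ᵇ_) y                                                     ≡⟨ sym (ℤ.+-identityʳ _) ⟩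
    + inflow (0 ≡ᵇ_) y ℤ.- + 0                                             ≡⟨ cong (λ k → + inflow (0 ≡ᵇ_) y ℤ.- + k) (sym (*-zeroʳ (suc p))) ⟩
    + inflow (0 ≡ᵇ_) y ℤ.- + (suc p * 𝟙 false)                             ≡⟨ cong (λ b → + inflow (0 ≡ᵇ_) y ℤ.- + (suc p * 𝟙 b)) (sym (grain-only y)) ⟩
    fired (0 ≡ᵇ_) (+ suc y)                                                ∎
    where
    open ≡-Reasoning
    b : Bool
    b = 0 ≡ᵇ y

  -- A column collects at most `2p + 1` in all, and the firing removes `p + 1`.
  fired-once : ∀ f y → f (y + p) ≡ true → fired f (+ suc y) ℤ.≤ + p
  fired-once f y e rewrite e = begin
    + inflow f y ℤ.- + (suc p * 1)           ≤⟨ ℤ.+-monoˡ-≤ (ℤ.- + (suc p * 1)) (ℤ.+≤+ bound) ⟩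
    + (p + suc p * 1) ℤ.- + (suc p * 1)      ≡⟨ cancel (+ p) (+ (suc p * 1)) ⟩
    + p                                      ∎
    where
    open ℤ.≤-Reasoning
    cancel : ∀ x y → x ℤ.+ y ℤ.- y ≡ x
    cancel = solve-∀
    bound : inflow f y ≤ p + suc p * 1
    bound = +-mono-≤ (nth≤p s y) (≤-trans (+-mono-≤ (n*𝟙≤n p (f (suc (y + p)))) (𝟙≤1 (f y)))
              (≤-reflexive (trans (+-comm p 1) (sym (*-identityʳ (suc p))))))

  unfired-slope : ∀ f y → f (y + p) ≡ false → fired f (+ suc y) ≡ + inflow f y
  unfired-slope f y e rewrite e | *-zeroʳ p = ℤ.+-identityʳ _

  beyond : ∀ {t f} → Reached t f → ∀ {x} → length s + p ≤ x → f x ≡ false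
  beyond {f = f} r {x} le with f x in e
  ... | false = refl
  ... | true  with support r e
  ...   | inj₁ refl = contradiction (n≤0⇒n≡0 le) (y+p≢0 (length s))
  ...   | inj₂ (y , y<s , refl) = contradiction (+-cancelʳ-≤ p (length s) y le) (<⇒≱ y<s)

  inflow-beyond : ∀ {t f} → Reached t f → ∀ {y} → length s ≤ y → inflow f y ≡ 𝟙 (f y)
  inflow-beyond {f = f} r {y} le
    rewrite nth-beyond s le | beyond r (≤-trans (+-monoˡ-≤ p le) (n≤1+n (y + p))) | *-zeroʳ p = refl

  -- Column 0 receives at most `p`. A column beyond `s` has slope 0 and no fired right neighbour, so
  -- it reaches at most 1, which is stable as `1 ≤ p`. Columns that have fired are excluded by
  -- `fired-once`.
  unstable : ∀ {t f i} → Reached t f → + p ℤ.< t i →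
             ∃[ y ] i ≡ + suc y × y < length s × f (y + p) ≡ false × p < inflow f y
  unstable {t} {f} {i} r p<t = go i (subst (+ p ℤ.<_) (slopes≡ r i) p<t)
    where
    go : ∀ i → + p ℤ.< fired f i → ∃[ y ] i ≡ + suc y × y < length s × f (y + p) ≡ false × p < inflow f y
    go (+ zero)  p< = contradiction (n*𝟙≤n p (f p)) (<⇒≱ (ℤ.drop‿+<+ p<))
    go -[1+ _ ]  p< = contradiction (ℤ.drop‿+<+ p<) λ ()
    go (+ suc y) p< with f (y + p) in e
    ... | true  = contradiction (fired-once f y e) (ℤ.<⇒≱ (subst (λ b → + p ℤ.< + inflow f y ℤ.- + (suc p * 𝟙 b)) (sym e) p<))
    ... | false = y , refl , ≰⇒> inside , e , p<inflow
      where
      p<inflow : p < inflow f y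
      p<inflow = ℤ.drop‿+<+ (subst (+ p ℤ.<_) (trans (cong (λ b → + inflow f y ℤ.- + (suc p * 𝟙 b)) (sym e)) (unfired-slope f y e)) p<)
      inside : ¬ (length s ≤ y)
      inside le = <⇒≱ p<inflow (≤-trans (≤-reflexive (inflow-beyond r le)) (≤-trans (𝟙≤1 (f y)) 1≤p))

  reached-fire : ∀ {t f y} → Reached t f → y < length s → f (y + p) ≡ false →
                 Reached (fire p (+ suc y) t) (mark (y + p) f)
  reached-fire r y<s e .slopes≡ = fire-fired (slopes≡ r) e
  reached-fire {f = f} {y} r y<s e .grain = mark-keeps (y + p) f 0 (grain r)
  reached-fire {f = f} {y} r y<s e .support {x} m with mark-true (y + p) f x m
  ... | inj₁ refl = inj₂ (y , y<s , refl)
  ... | inj₂ m′   = support r m′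

  -- Minimality of the set of fired columns

  inflow-mono : ∀ {f g} → (∀ {x} → f x ≡ true → g x ≡ true) → ∀ y → inflow f y ≤ inflow g y
  inflow-mono f≤g y = +-monoʳ-≤ (nth s y) (+-mono-≤ (*-monoʳ-≤ p (𝟙-mono (f≤g {suc (y + p)}))) (𝟙-mono (f≤g {y})))

  -- As long as all fired columns lie in `g`, the inflow they cause is at most that caused by `g`. A
  -- column outside `g` therefore stays at most `p`, and the next firing is again in `g`.
  reached-closed : ∀ {g} → (∀ y → y < length s → stable-at s g y) →
                   ∀ {t u f} → Reached t f → (∀ {x} → f x ≡ true → g x ≡ true) → Star (Step p) t u →
                   ∃[ h ] Reached u h × (∀ {x} → h x ≡ true → g x ≡ true)
  reached-closed st {f = f} r f≤g ε = f , r , f≤g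
  reached-closed {g} st {f = f} r f≤g (step i p<t ◅ steps) with unstable r p<t
  ... | y , refl , y<s , unf , p<in = reached-closed st (reached-fire r y<s unf) marked≤g steps
    where
    forced : g (y + p) ≡ true
    forced with g (y + p) in e
    ... | true  = refl
    ... | false = contradiction (≤-trans (inflow-mono {f} {g} f≤g y) (st y y<s e)) (<⇒≱ p<in)
    marked≤g : ∀ {x} → mark (y + p) f x ≡ true → g x ≡ true
    marked≤g {x} m with mark-true (y + p) f x m
    ... | inj₁ refl = forced
    ... | inj₂ m′   = f≤g m′

  -- A nonempty `s` contains column 1, so the added grain is not seen at column `k`.
  addGrain-beyond : 0 < length s → ∀ z → addGrain (slopes s) (+ suc (length s + z)) ≡ + 0
  addGrain-beyond 0<s z with length s in e
  ... | suc l = cong +_ (nth-beyond s (≤-trans (≤-reflexive e) (m≤m+n (suc l) z)))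

  -- Beyond `s`, neither a column nor its right neighbour fires, so only the column `p` to the left
  -- contributes. The question about `k` thus becomes whether `k - p` fires.
  fired-beyond : ∀ {t f} → Reached t f → ∀ z → t (+ suc (length s + z)) ≡ + 𝟙 (f (length s + z))
  fired-beyond {f = f} r z = trans (slopes≡ r (+ suc (length s + z)))
    (trans (unfired-slope f (length s + z) (beyond r (+-monoˡ-≤ p (m≤m+n (length s) z))))
           (cong +_ (inflow-beyond r (m≤m+n (length s) z))))

  triggers⇒ : 0 < length s → ∀ {z} → Triggers p s (suc (length s + z)) →
              ∀ {g} → g 0 ≡ true → (∀ y → y < length s → stable-at s g y) → g (length s + z) ≡ true
  triggers⇒ 0<s {z} (t , steps , _ , increased) {g} g0 st
    with reached-closed st reached-start start≤g steps
    where
    start≤g : ∀ {x} → (0 ≡ᵇ x) ≡ true → g x ≡ true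
    start≤g {zero} _ = g0
  ... | f , r , f≤g = f≤g (positive (subst₂ ℤ._<_ (addGrain-beyond 0<s z) (fired-beyond r z) increased))
    where
    positive : ∀ {b} → + 0 ℤ.< + 𝟙 b → b ≡ true
    positive {true}  _ = refl
    positive {false} (ℤ.+<+ ())

  -- Termination and closure of the set of fired columns

  unfired-columns : Labelling → ℕ → ℕ
  unfired-columns f zero    = 0
  unfired-columns f (suc n) = 𝟙 (not (f (n + p))) + unfired-columns f n

  not-mark : ∀ x f z → 𝟙 (not (mark x f z)) ≤ 𝟙 (not (f z))
  not-mark x f z with x ≡ᵇ z
  ... | true  = z≤n
  ... | false = ≤-refl

  unfired-mono : ∀ x f n → unfired-columns (mark x f) n ≤ unfired-columns f n
  unfired-mono x f zero    = z≤n
  unfired-mono x f (suc n) = +-mono-≤ (not-mark x f (n + p)) (unfired-mono x f n)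

  unfired-decreases : ∀ {f y} n → y < n → f (y + p) ≡ false →
                      unfired-columns (mark (y + p) f) n < unfired-columns f n
  unfired-decreases {f} {y} (suc n) (s≤s y≤n) e with m≤n⇒m<n∨m≡n y≤n
  ... | inj₁ y<n  = +-mono-≤-< (not-mark (y + p) f (n + p)) (unfired-decreases n y<n e)
  ... | inj₂ refl rewrite mark-self (y + p) f | e = s≤s (unfired-mono (y + p) f y)

  -- The fuel `n` bounds the number of columns of `s` that have not fired; every firing lowers that
  -- number.
  stabilize : ∀ n {t f} → unfired-columns f (length s) ≤ n → Reached t f →
              ∃[ u ] ∃[ h ] Star (Step p) t u × Stable p u × Reached u h
  stabilize n {t} {f} le r with Fin.any? {n = length s} (λ i → + p ℤ.<? t (+ suc (toℕ i)))
  ... | no ¬unstable = t , f , ε , (λ i → ℤ.≮⇒≥ λ p<t →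
          let y , i≡ , y<s , _ = unstable r p<t in
          ¬unstable (fromℕ< y<s , subst (λ j → + p ℤ.< t j) (trans i≡ (cong (λ k → + suc k) (sym (Fin.toℕ-fromℕ< y<s)))) p<t)) , r
  ... | yes (i , p<t) with unstable r p<t
  ...   | y , refl , y<s , unf , _ with n | ≤-trans (unfired-decreases (length s) y<s unf) le
  ...     | suc n′ | s≤s le′ =
    let u , h , steps , st , r′ = stabilize n′ le′ (reached-fire r y<s unf) in
    u , h , step _ p<t ◅ steps , st , r′

  stable-labelling : ∀ {t f} → Reached t f → Stable p t → ∀ y → stable-at s f y
  stable-labelling {f = f} r st y e =
    ℤ.drop‿+≤+ (subst (ℤ._≤ + p) (trans (slopes≡ r (+ suc y)) (unfired-slope f y e)) (st (+ suc y)))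

  -- Stability of the final configuration makes its own labelling closed, so the hypothesis can be
  -- applied to that labelling.
  triggers⇐ : 0 < length s → ∀ {z} →
              (∀ {g} → g 0 ≡ true → (∀ y → stable-at s g y) → g (length s + z) ≢ false) →
              Triggers p s (suc (length s + z))
  triggers⇐ 0<s {z} forced with stabilize _ ≤-refl reached-start
  ... | t , f , steps , st , r = t , steps , st ,
    subst₂ ℤ._<_ (sym (addGrain-beyond 0<s z))
      (sym (trans (fired-beyond r z) (cong (λ b → + 𝟙 b) (Bool.¬-not (forced (grain r) (stable-labelling r st))))))
      (ℤ.+<+ (s≤s z≤n))

-- The complement of the avalanche problem is accepted by the automaton

module _ (p : ℕ) (1≤p : 1 ≤ p) where

  open Columns p

  empty-triggers : ∀ {k} → ¬ Triggers p [] k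
  empty-triggers (_ , ε , _ , increased)       = ℤ.<-irrefl refl increased
  empty-triggers (_ , step i p<t ◅ _ , _ , _) with Avalanche.unstable p 1≤p [] {i = i} (Avalanche.reached-start p 1≤p []) p<t
  ... | _ , _ , () , _

  blocks-layout : ∀ s z → Blocks p automaton (List.map block (layout s z))
  blocks-layout s z = All.map⁺ (All.universal length-block (layout s z))

  length-concat : ∀ {Bs} → Blocks p automaton Bs → length (concat Bs) ≡ length Bs * suc p
  length-concat []                    = refl
  length-concat {B ∷ Bs} (len ∷ ok) = trans (List.length-++ B) (cong₂ _+_ len (length-concat ok))

  ++-injective : ∀ {A : Set} {us vs : List A} xs ys → length xs ≡ length ys → xs ++ us ≡ ys ++ vs → xs ≡ ys × us ≡ vs
  ++-injective []       []       _ e = refl , e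
  ++-injective (x ∷ xs) (y ∷ ys) l e =
    let e₁ , e₂ = List.∷-injective e ; e₃ , e₄ = ++-injective xs ys (suc-injective l) e₂ in cong₂ _∷_ e₁ e₃ , e₄

  concat-injective : ∀ {Bs Cs} → Blocks p automaton Bs → Blocks p automaton Cs → concat Bs ≡ concat Cs → Bs ≡ Cs
  concat-injective []         []          _ = refl
  concat-injective []         (_∷_ {_ ∷ _} _ _) ()
  concat-injective (_∷_ {_ ∷ _} _ _) []         ()
  concat-injective (_∷_ {B} l ok) (_∷_ {C} m ok′) e =
    let e₁ , e₂ = ++-injective B C (trans l (sym m)) e in cong₂ _∷_ e₁ (concat-injective ok ok′ e₂)

  -- Modulo `p + 1` the common length is that of `l`, which is at most `p`, and also 0.
  aligned : ∀ {l Bs Cs} → length l ≤ p → Blocks p automaton Bs → Blocks p automaton Cs →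
            l ++ concat Bs ≡ concat Cs → l ≡ [] × Bs ≡ Cs
  aligned {l} {Bs} {Cs} l≤p ok ok′ e = split l l≡0 e
    where
    open ≡-Reasoning
    l≡0 : length l ≡ 0
    l≡0 = begin
      length l                                ≡⟨ sym (m<n⇒m%n≡m (s≤s l≤p)) ⟩
      length l % suc p                        ≡⟨ sym ([m+kn]%n≡m%n (length l) (length Bs) (suc p)) ⟩
      (length l + length Bs * suc p) % suc p  ≡⟨ cong (λ k → (length l + k) % suc p) (sym (length-concat ok)) ⟩
      (length l + length (concat Bs)) % suc p ≡⟨ cong (_% suc p) (sym (List.length-++ l)) ⟩
      length (l ++ concat Bs) % suc p         ≡⟨ cong (λ w → length w % suc p) e ⟩
      length (concat Cs) % suc p              ≡⟨ cong (_% suc p) (length-concat ok′) ⟩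
      (length Cs * suc p) % suc p             ≡⟨ m*n%n≡0 (length Cs) (suc p) ⟩
      0                                       ∎
    split : ∀ l → length l ≡ 0 → l ++ concat Bs ≡ concat Cs → l ≡ [] × Bs ≡ Cs
    split [] _ e = refl , concat-injective ok ok′ e

  -- Blocks are formed from the right, which leaves an incomplete one at the front, where
  -- `bitAutomaton` may start inside a block.
  cut : ∀ w → ∃[ l ] ∃[ Bs ] length l ≤ p × Blocks p automaton Bs × w ≡ l ++ concat Bs
  cut []      = [] , [] , z≤n , [] , refl
  cut (b ∷ w) with cut w
  ... | l , Bs , l≤p , ok , refl with length l ≟ p
  ...   | yes l≡p = [] , (b ∷ l) ∷ Bs , z≤n , cong suc l≡p ∷ ok , refl
  ...   | no l≢p  = b ∷ l , Bs , ≤∧≢⇒< l≤p l≢p , ok , refl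

  AP⇒¬accepted : ∀ {w} → AP p w → ¬ Accepted (bitAutomaton p automaton) w
  AP⇒¬accepted ([] , _ , _ , _ , trig) _ = empty-triggers trig
  AP⇒¬accepted (s@(v ∷ s′) , k , (|s|<k , k≤) , refl , trig) ((β , q) , start , ρ)
    with m≤n⇒∃[o]m+o≡n |s|<k
  ... | z , refl with bit⇒block p automaton (encode s (suc (length s + z))) ρ
  ... | Bs , ok , e , ρ′
    with aligned (length-contents p automaton β) ok (blocks-layout s z) (trans (sym e) (encode-layout s z))
  ... | l≡[] , refl = refute q start ρ′
    where
    z<p : z < p
    z<p = +-cancelˡ-≤ (length s) (suc z) p (subst (_≤ length s + p) (sym (+-suc (length s) z)) k≤)
    refute : ∀ q → contents p automaton β ≢ [] ⊎ Initial q → ¬ Run automaton (List.map block (layout s z)) q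
    refute q        (inj₁ l≢[])   _ = l≢[] l≡[]
    refute (inj₁ f) (inj₂ f≢body) ρ = f≢body (trans (run-parse⇒ (List.map block (layout s z)) ρ) (parse-layout v s′ z z<p))
    refute (inj₂ (b ∷ W)) (inj₂ refl) ρ =
      let g , w , cl = run-window⇒ (layout s z) ρ ; st , marked = closed-layout⇒ s g z<p cl in
      contradiction (trans (sym marked) (Avalanche.triggers⇒ p 1≤p s (s≤s z≤n) trig {g} (sym (w zero)) st)) λ ()

  ¬accepted⇒AP : ∀ w → ¬ Accepted (bitAutomaton p automaton) w → AP p w
  ¬accepted⇒AP w rejected with cut w
  -- After a nonempty front piece any state may follow; the parser supplies one with an accepting
  -- run, whatever `Bs` is.
  ... | x ∷ l , Bs , l≤p , ok , refl =
    let β , e = buffer p automaton (x ∷ l) l≤p in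
    contradiction ((β , inj₁ (parse Bs)) , inj₁ (λ e′ → contradiction (trans (sym e) e′) λ ()) ,
                   block⇒bit p automaton (x ∷ l) Bs ok (run-parse⇐ Bs) β e) rejected
  ... | [] , Bs , _ , ok , refl = go (parse Bs ≟ᵖ body)
    where
    rejected-block : ¬ Accepted automaton Bs
    rejected-block (q , start , ρ) =
      let β , e = buffer p automaton [] z≤n in rejected ((β , q) , inj₂ start , block⇒bit p automaton [] Bs ok ρ β e)
    go : Dec (parse Bs ≡ body) → AP p (concat Bs)
    go (no ¬body) = contradiction (inj₁ (parse Bs) , ¬body , run-parse⇐ Bs) rejected-block
    go (yes is-body) with subst (λ e → Parsed e Bs) is-body (parsed Bs)
    ... | v , s′ , z , z<p , refl =
      s , suc (length s + z) , (s≤s (m≤m+n (length s) z) , ≤-trans (≤-reflexive (sym (+-suc (length s) z))) (+-monoʳ-≤ (length s) z<p)) ,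
      sym (encode-layout s z) ,
      Avalanche.triggers⇐ p 1≤p s (s≤s z≤n) λ {g} g0 st unmarked →
        rejected-block (inj₂ (window g) , g0 , run-window⇐ (layout s z) g (closed-layout⇐ s g st unmarked))
      where
      s : gSM p
      s = v ∷ s′

theorem1 : ∀ (p : ℕ) → 1 ≤ p → NC¹ (AP p)
theorem1 p 1≤p = coregular⇒nc¹ (bitAutomaton p automaton) λ w → mk⇔ (AP⇒¬accepted p 1≤p) (¬accepted⇒AP p 1≤p w)
  where open Columns p
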